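{- Let $p$ be a prime, let $G$ be a finite additive abelian $p$-group, and let $h\in\{0,1,2,\ldots\}$. Let $A=\{a_s(n_s)\}_{s=1}^k$ (with $a_s\in\mathbb Z$, $n_s\in\mathbb Z^+$) be a $(d^*(G)+p^h)$-cover of $\mathbb Z$. Let $c_1,\ldots,c_k\in G$ and $m_1,\ldots,m_k\in\mathbb Z$. Then for any $c\in G$ and any rational number $\alpha$, $$\Big|\Big\{I\subseteq\{1,\ldots,k\}:\ \sum_{s\in I}c_s=c\ \text{and}\ \sum_{s\in I}\frac{m_s}{n_s}\in\alpha+p^h\mathbb Z\Big\}\Big|\neq 1.$$ In particular, there is a nonempty $I\subseteq\{1,\ldots,k\}$ with $\sum_{s\in I}c_s=0$ and $\sum_{s\in I}m_s/n_s\in p^h\mathbb Z$.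
   Context: For $a\in\mathbb Z$ and $n\in\mathbb Z^+$, $a(n)=a+n\mathbb Z$ is a residue class. For a finite system $A=\{a_s(n_s)\}_{s=1}^k$, its covering function is $w_A(x)=|\{1\le s\le k: x\in a_s(n_s)\}|$; $A$ is an $m$-cover of $\mathbb Z$ if $w_A(x)\ge m$ for all $x\in\mathbb Z$. For a finite abelian group $G$ with $|G|>1$, write $G\cong\mathbb Z_{d_1}\oplus\cdots\oplus\mathbb Z_{d_r}$ with $1<d_1\mid d_2\mid\cdots\mid d_r$ (unique such decomposition) and set $d^*(G)=\sum_{i=1}^r(d_i-1)$; if $|G|=1$ set $d^*(G)=0$. -}

module Defs where

open import Level using (Level; 0ℓ; _⊔_)
open import Data.Product using (Σ; ∃; _×_; _,_)
open import Data.Nat as ℕ using (ℕ; zero; suc; _<_; _≤_; _∸_)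
open import Data.Nat.Divisibility as ℕD using (_∣?_)
open import Data.Integer as ℤ using (ℤ; +_)
open import Data.Integer.Divisibility as ℤD
open import Data.Fin using (Fin; zero; suc; toℕ)
open import Data.Fin.Subset using (Subset)
open import Data.Vec using ([]; _∷_)
open import Data.List using (length; filter; map; allFin)
open import Data.Nat.ListAction using (sum)
open import Data.Bool using (true; false)
open import Algebra.Bundles using (RawGroup; AbelianGroup)
open import Algebra.Morphism.Structures using (module GroupMorphisms)

-- Covering function and m-covers.
-- A system {a_s(n_s)}_{s=1}^k is given by a n : Fin k → ℤ / ℕ (n s > 0).
-- x ∈ a(n)  iff  n ∣ x - a  (integer divisibility, i.e. n ∣ |x - a|).

coveringFunction : (k : ℕ) → (Fin k → ℤ) → (Fin k → ℕ) → ℤ → ℕ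
coveringFunction k a n x =
  length (filter (λ s → n s ∣? ℤ.∣ x ℤ.- a s ∣) (allFin k))

IsMCover : ℕ → (k : ℕ) → (Fin k → ℤ) → (Fin k → ℕ) → Set
IsMCover m k a n = (x : ℤ) → m ≤ coveringFunction k a n x

IsInvariantFactors : (r : ℕ) → (Fin r → ℕ) → Set
IsInvariantFactors r ds =
  ((i : Fin r) → 1 < ds i) × ((i j : Fin r) → toℕ i ≤ toℕ j → ds i ℕD.∣ ds j)

dstarOf : (r : ℕ) → (Fin r → ℕ) → ℕ
dstarOf r ds = sum (map (λ i → ds i ∸ 1) (allFin r))

ZSum : (r : ℕ) → (Fin r → ℕ) → RawGroup 0ℓ 0ℓ
ZSum r ds = record
  { Carrier = Fin r → ℤ
  ; _≈_ = λ x y → (i : Fin r) → (+ ds i) ℤD.∣ (x i ℤ.- y i)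
  ; _∙_ = λ x y i → x i ℤ.+ y i
  ; ε = λ _ → + 0
  ; _⁻¹ = λ x i → ℤ.- x i
  }

IsoToSum : ∀ {c ℓ : Level} → AbelianGroup c ℓ → (r : ℕ) → (Fin r → ℕ) → Set (c ⊔ ℓ)
IsoToSum G r ds = ∃ λ (φ : Carrier → (Fin r → ℤ)) → IsGroupIsomorphism φ
  where
  open AbelianGroup G using (rawGroup; Carrier)
  open GroupMorphisms rawGroup (ZSum r ds)

-- d*(G) = D : G ≅ Z_{d_1} ⊕ ... ⊕ Z_{d_r} with 1 < d_1 ∣ ... ∣ d_r and D = Σ (d_i - 1).
-- (By the structure theorem such a decomposition exists for finite G and
--  the d_i are unique, so this relation is a function of G.)
DStar : ∀ {c ℓ : Level} → AbelianGroup c ℓ → ℕ → Set (c ⊔ ℓ)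
DStar G D = Σ ℕ λ r → Σ (Fin r → ℕ) λ ds →
  IsInvariantFactors r ds × IsoToSum G r ds × (D ≡' dstarOf r ds)
  where open import Relation.Binary.PropositionalEquality using () renaming (_≡_ to _≡'_)

module _ {c ℓ : Level} (G : AbelianGroup c ℓ) where
  open AbelianGroup G

  natMul : ℕ → Carrier → Carrier
  natMul zero g = ε
  natMul (suc e) g = g ∙ natMul e g

  IsPGroup : ℕ → Set (c ⊔ ℓ)
  IsPGroup p = (g : Carrier) → ∃ λ e → natMul (p ℕ.^ e) g ≈ ε

subsetSum : ∀ {a} {A : Set a} → (A → A → A) → A → ∀ {k} → Subset k → (Fin k → A) → A
subsetSum _+_ e [] f = e
subsetSum _+_ e (true ∷ I) f = f zero + subsetSum _+_ e I (λ s → f (suc s))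
subsetSum _+_ e (false ∷ I) f = subsetSum _+_ e I (λ s → f (suc s))

{-# OPTIONS --safe #-}
-- Changing the sign of c_s and m_s for s ∈ I turns J into the symmetric difference of I and J, so it
-- suffices to find a nonempty I with zero sum. Let N p^v with p ∤ N be a common multiple of the
-- moduli, n_s = n′_s p^(u_s) with p ∤ n′_s, and M_s = (m_s / n_s) N p^v. For each residue x mod N
-- take the product of a function of Σ_I (a_s - x) M_s mod N with indicator functions of the
-- conditions p^(v+h) ∣ Σ_I M_s and Σ_I c_s = 0. Summing over x, the first factor detects
-- N ∣ Σ_I M_s, so the sum F(I) vanishes unless I has zero sum, while F(∅) = N. Hence it is enough
-- that p divides the alternating sum of F(I) over all I, and this holds for each x separately:
-- give s the weight p^(v - u_s) if n′_s ∣ a_s - x, and 0 otherwise. The indicator of p^f ℤ has degree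
-- p^f - 1 modulo p, since Δ_1^(p^f) ≡ Δ_(p^f), so the product has weighted degree less than
-- p^v (D + p^h). Counting how the integers congruent to x mod N are covered shows that the total
-- weight is at least this number, so the top difference of the product vanishes modulo p.

module Submission where

open import Defs
open import Level using (Level)
open import Data.Nat as ℕ using (ℕ; zero; suc; _≤_; _<_; _∸_; _^_; _!; z≤n; s≤s; NonZero)
import Data.Nat.Properties as ℕₚ
import Data.Nat.Divisibility as ℕD
open import Data.Nat.Combinatorics using (_C_; nCk+nC[k+1]≡[n+1]C[k+1]; nCn≡1; nCk≡nC[n∸k]; k![n∸k]!∣n!)
open import Data.Nat.Combinatorics.Specification using (nCk≡n!/k![n-k]!; k>n⇒nCk≡0)
open import Data.Nat.DivMod using (m/n*n≡m)
open import Data.Nat.GCD using (gcd; gcd[m,n]∣m; gcd[m,n]∣n; gcd-GCD; module Bézout)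
open import Data.Nat.ListAction using (sum; product)
open import Data.Nat.Primality using (Prime; prime?; euclidsLemma; prime⇒nonZero; prime⇒nonTrivial)
open import Data.Nat.Primality.Factorisation using (factorise)
import Data.Nat.Tactic.RingSolver as ℕSolver
open import Data.Integer as ℤ using (ℤ; +_; -[1+_]; 0ℤ; 1ℤ)
import Data.Integer.Properties as ℤₚ
open import Data.Integer.Divisibility.Signed
  using (_∣_; divides; _∣?_; ∣ᵤ⇒∣; ∣⇒∣ᵤ; ∣-trans; ∣m∣n⇒∣m+n; ∣m∣n⇒∣m-n; ∣m⇒∣-m; ∣m⇒∣m*n; ∣n⇒∣m*n;
         ∣m+n∣n⇒∣m; m∣∣m∣; *-monoˡ-∣)
open import Data.Integer.Tactic.RingSolver using (solve-∀)
open import Data.Rational as ℚ using (ℚ; _/_; 0ℚ)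
import Data.Rational.Properties as ℚₚ
open import Data.Rational.Unnormalised as ℚᵘ using (mkℚᵘ; *≡*)
import Data.Rational.Unnormalised.Properties as ℚᵘₚ
open import Data.Bool using (true; false; if_then_else_; _xor_)
open import Data.Fin as Fin using (Fin; zero; suc)
open import Data.Fin.Subset using (Subset; Nonempty) renaming (⊥ to ∅)
open import Data.List using ([]; _∷_; length; filter; tabulate)
open import Data.List.Properties using (map-tabulate)
open import Data.List.Relation.Unary.All using (_∷_)
open import Data.Product using (∃; _×_; _,_; proj₁; proj₂)
open import Data.Sum using (_⊎_; inj₁; inj₂; [_,_]′)
open import Data.Unit using (⊤; tt)
open import Data.Vec using ([]; _∷_; here; there; lookup; zipWith; tail)
open import Function using (_∘_; id; it)
open import Relation.Nullary using (¬_; Dec; does; yes; no; contradiction)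
open import Relation.Unary using (Pred; Decidable)
open import Relation.Binary.PropositionalEquality
  using (_≡_; refl; sym; trans; cong; cong₂; subst; subst₂; module ≡-Reasoning)
open import Algebra.Bundles using (AbelianGroup)
open import Algebra.Morphism.Structures using (module GroupMorphisms)
import Algebra.Properties.AbelianGroup as AbelianGroupProperties
import Algebra.Properties.CommutativeSemigroup as CommutativeSemigroupProperties
open AbelianGroupProperties ℤₚ.+-0-abelianGroup using (∙-cancelˡ)

module IntegralZeroSum where

  open import Data.Integer using (_+_; _*_; _-_; -_)

  -- Congruences of integers and finite sums

  infix 4 _≡[_]_

  -- Wrapping the divisibility in a record lets `a`, `b` and `p` be inferred, since the difference
  -- `a - b` does not determine its terms.
  record _≡[_]_ (a : ℤ) (p : ℕ) (b : ℤ) : Set where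
    constructor ∣⇒≡[]
    field ≡[]⇒∣ : + p ∣ a - b
  open _≡[_]_ public

  k∣0 : ∀ k → k ∣ 0ℤ
  k∣0 k = divides 0ℤ refl

  ≡⇒≡[] : ∀ {p a b} → a ≡ b → a ≡[ p ] b
  ≡⇒≡[] {p} {a} refl = ∣⇒≡[] (subst (+ p ∣_) (sym (ℤₚ.+-inverseʳ a)) (k∣0 (+ p)))

  ≡[]-sym : ∀ {p a b} → a ≡[ p ] b → b ≡[ p ] a
  ≡[]-sym {p} {a} {b} (∣⇒≡[] q) = ∣⇒≡[] (subst (+ p ∣_) (lemma a b) (∣m⇒∣-m q))
    where
    lemma : ∀ a b → - (a - b) ≡ b - a
    lemma = solve-∀

  ≡[]-trans : ∀ {p a b c} → a ≡[ p ] b → b ≡[ p ] c → a ≡[ p ] c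
  ≡[]-trans {p} {a} {b} {c} (∣⇒≡[] q) (∣⇒≡[] r) = ∣⇒≡[] (subst (+ p ∣_) (lemma a b c) (∣m∣n⇒∣m+n q r))
    where
    lemma : ∀ a b c → (a - b) + (b - c) ≡ a - c
    lemma = solve-∀

  ≡[]-+ : ∀ {p a b c d} → a ≡[ p ] b → c ≡[ p ] d → a + c ≡[ p ] b + d
  ≡[]-+ {p} {a} {b} {c} {d} (∣⇒≡[] q) (∣⇒≡[] r) = ∣⇒≡[] (subst (+ p ∣_) (lemma a b c d) (∣m∣n⇒∣m+n q r))
    where
    lemma : ∀ a b c d → (a - b) + (c - d) ≡ (a + c) - (b + d)
    lemma = solve-∀

  ≡[]-sub : ∀ {p a b c d} → a ≡[ p ] b → c ≡[ p ] d → a - c ≡[ p ] b - d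
  ≡[]-sub {p} {a} {b} {c} {d} (∣⇒≡[] q) (∣⇒≡[] r) = ∣⇒≡[] (subst (+ p ∣_) (lemma a b c d) (∣m∣n⇒∣m-n q r))
    where
    lemma : ∀ a b c d → (a - b) - (c - d) ≡ (a - c) - (b - d)
    lemma = solve-∀

  ≡[]-∣ : ∀ {p a b} → a ≡[ p ] b → + p ∣ a → + p ∣ b
  ≡[]-∣ {p} {a} {b} (∣⇒≡[] q) r = subst (+ p ∣_) (lemma a b) (∣m∣n⇒∣m-n r q)
    where
    lemma : ∀ a b → a - (a - b) ≡ b
    lemma = solve-∀

  Σ< : ℕ → (ℕ → ℤ) → ℤ
  Σ< zero    g = 0ℤ
  Σ< (suc n) g = g 0 + Σ< n (g ∘ suc)

  Σ<-cong : ∀ n {g h : ℕ → ℤ} → (∀ k → g k ≡ h k) → Σ< n g ≡ Σ< n h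
  Σ<-cong zero    e = refl
  Σ<-cong (suc n) e = cong₂ _+_ (e 0) (Σ<-cong n (e ∘ suc))

  Σ<-+ : ∀ n g h → Σ< n (λ k → g k + h k) ≡ Σ< n g + Σ< n h
  Σ<-+ zero    g h = refl
  Σ<-+ (suc n) g h = trans (cong (_+_ (g 0 + h 0)) (Σ<-+ n (g ∘ suc) (h ∘ suc)))
    (lemma (g 0) (h 0) (Σ< n (g ∘ suc)) (Σ< n (h ∘ suc)))
    where
    lemma : ∀ a b c d → (a + b) + (c + d) ≡ (a + c) + (b + d)
    lemma = solve-∀

  Σ<-last : ∀ n g → Σ< (suc n) g ≡ Σ< n g + g n
  Σ<-last zero    g = ℤₚ.+-comm (g 0) 0ℤ
  Σ<-last (suc n) g = trans (cong (_+_ (g 0)) (Σ<-last n (g ∘ suc)))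
    (sym (ℤₚ.+-assoc (g 0) (Σ< n (g ∘ suc)) (g (suc n))))

  Σ<-∣ : ∀ {d} n {g} → (∀ k → k < n → d ∣ g k) → d ∣ Σ< n g
  Σ<-∣ {d} zero _ = k∣0 d
  Σ<-∣ (suc n) e = ∣m∣n⇒∣m+n (e 0 (s≤s z≤n)) (Σ<-∣ n (λ k k<n → e (suc k) (s≤s k<n)))

  -- Finite differences modulo a prime

  Δ : ℤ → (ℤ → ℤ) → ℤ → ℤ
  Δ m f y = f (y + m) - f y

  Δ^ : ℕ → ℤ → (ℤ → ℤ) → ℤ → ℤ
  Δ^ zero    m f = f
  Δ^ (suc n) m f = Δ^ n m (Δ m f)

  Δ^-resp : ∀ {p} n m {f g} → (∀ y → f y ≡[ p ] g y) → ∀ y → Δ^ n m f y ≡[ p ] Δ^ n m g y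
  Δ^-resp zero    m e = e
  Δ^-resp (suc n) m e = Δ^-resp n m (λ y → ≡[]-sub (e (y + m)) (e y))

  Δ^-+ : ∀ a b m f → Δ^ (a ℕ.+ b) m f ≡ Δ^ b m (Δ^ a m f)
  Δ^-+ zero    b m f = refl
  Δ^-+ (suc a) b m f = Δ^-+ a b m (Δ m f)

  Δ^-Δ : ∀ n m f y → Δ^ n m (Δ m f) y ≡ Δ m (Δ^ n m f) y
  Δ^-Δ zero    m f y = refl
  Δ^-Δ (suc n) m f y = Δ^-Δ n m (Δ m f) y

  -- Induction on `n`: one further step `m` adds `Δ m f (y + n m)`, so the hypothesis is applied to
  -- both `f` and `Δ m f`, and Pascal's rule merges the two sums.
  newton : ∀ n m f y → f (y + + n * m) ≡ Σ< (suc n) (λ k → + (n C k) * Δ^ k m f y)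
  newton zero m f y = begin
    f (y + 0ℤ * m)        ≡⟨ cong f (trans (cong (_+_ y) (ℤₚ.*-zeroˡ m)) (ℤₚ.+-identityʳ y)) ⟩
    f y                   ≡⟨ unit (f y) ⟩
    1ℤ * f y + 0ℤ         ∎
    where
    open ≡-Reasoning
    unit : ∀ u → u ≡ 1ℤ * u + 0ℤ
    unit = solve-∀
  newton (suc n) m f y = begin
    f (y + + suc n * m)
      ≡⟨ cong f (reassoc y (+ n) m) ⟩
    f ((y + + n * m) + m)
      ≡⟨ split (f ((y + + n * m) + m)) (f (y + + n * m)) ⟩
    f (y + + n * m) + Δ m f (y + + n * m)
      ≡⟨ cong₂ _+_ (newton n m f y) (newton n m (Δ m f) y) ⟩
    Σ< (suc n) (λ k → + (n C k) * a k) + Σ< (suc n) (λ k → + (n C k) * a (suc k))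
      ≡⟨ cong (_+ Σ< (suc n) (λ k → + (n C k) * a (suc k))) extend ⟩
    (+ (n C 0) * a 0 + Σ< (suc n) (λ k → + (n C suc k) * a (suc k))) + Σ< (suc n) (λ k → + (n C k) * a (suc k))
      ≡⟨ rearrange (+ (n C 0) * a 0) _ _ ⟩
    + (n C 0) * a 0 + (Σ< (suc n) (λ k → + (n C k) * a (suc k)) + Σ< (suc n) (λ k → + (n C suc k) * a (suc k)))
      ≡⟨ cong (_+_ (+ (n C 0) * a 0)) (sym (Σ<-+ (suc n) (λ k → + (n C k) * a (suc k)) (λ k → + (n C suc k) * a (suc k)))) ⟩
    + (n C 0) * a 0 + Σ< (suc n) (λ k → + (n C k) * a (suc k) + + (n C suc k) * a (suc k))
      ≡⟨ cong (_+_ (+ (n C 0) * a 0)) (Σ<-cong (suc n) pascal) ⟩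
    Σ< (suc (suc n)) (λ k → + (suc n C k) * a k) ∎
    where
    open ≡-Reasoning
    a : ℕ → ℤ
    a k = Δ^ k m f y
    reassoc : ∀ y n m → y + (1ℤ + n) * m ≡ (y + n * m) + m
    reassoc = solve-∀
    split : ∀ u v → u ≡ v + (u - v)
    split = solve-∀
    rearrange : ∀ u v w → (u + v) + w ≡ u + (w + v)
    rearrange = solve-∀
    -- The sum on the right is one term longer; the additional binomial coefficient `n C suc n` is
    -- 0.
    extend : Σ< (suc n) (λ k → + (n C k) * a k) ≡ + (n C 0) * a 0 + Σ< (suc n) (λ k → + (n C suc k) * a (suc k))
    extend = cong (_+_ (+ (n C 0) * a 0)) (sym (begin
      Σ< (suc n) (λ k → + (n C suc k) * a (suc k))
        ≡⟨ Σ<-last n _ ⟩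
      Σ< n (λ k → + (n C suc k) * a (suc k)) + + (n C suc n) * a (suc n)
        ≡⟨ cong (λ c → Σ< n (λ k → + (n C suc k) * a (suc k)) + + c * a (suc n)) (k>n⇒nCk≡0 (ℕₚ.n<1+n n)) ⟩
      Σ< n (λ k → + (n C suc k) * a (suc k)) + 0ℤ * a (suc n)
        ≡⟨ cong (_+_ (Σ< n (λ k → + (n C suc k) * a (suc k)))) (ℤₚ.*-zeroˡ (a (suc n))) ⟩
      Σ< n (λ k → + (n C suc k) * a (suc k)) + 0ℤ
        ≡⟨ ℤₚ.+-identityʳ _ ⟩
      Σ< n (λ k → + (n C suc k) * a (suc k)) ∎))
    pascal : ∀ k → + (n C k) * a (suc k) + + (n C suc k) * a (suc k) ≡ + (suc n C suc k) * a (suc k)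
    pascal k = trans (sym (ℤₚ.*-distribʳ-+ (a (suc k)) (+ (n C k)) (+ (n C suc k))))
      (cong (λ c → + c * a (suc k)) (nCk+nC[k+1]≡[n+1]C[k+1] n k))

  prime⇒1< : ∀ {p} → Prime p → 1 < p
  prime⇒1< pp = ℕ.nonTrivial⇒n>1 _ {{prime⇒nonTrivial pp}}

  prime∤! : ∀ {p} → Prime p → ∀ k → k < p → ¬ p ℕD.∣ k !
  prime∤! pp zero    k<p p∣1 = ℕₚ.<⇒≱ (prime⇒1< pp) (ℕD.∣⇒≤ p∣1)
  prime∤! pp (suc k) k<p p∣k! with euclidsLemma (suc k) (k !) pp p∣k!
  ... | inj₁ p∣1+k = ℕₚ.<⇒≱ k<p (ℕD.∣⇒≤ p∣1+k)
  ... | inj₂ p∣k!  = prime∤! pp k (ℕₚ.<-trans (ℕₚ.n<1+n k) k<p) p∣k!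

  n∣n! : ∀ n .{{_ : NonZero n}} → n ℕD.∣ n !
  n∣n! (suc n) = ℕD.m∣m*n (n !)

  -- `p` divides `p !`, which is the binomial coefficient times two factorials of numbers below `p`,
  -- and `p` divides neither of these.
  prime∣C : ∀ {p} → Prime p → ∀ k → suc k < p → p ℕD.∣ p C suc k
  prime∣C {p} pp k 1+k<p = [ id , (λ d → contradiction d p∤) ]′ (euclidsLemma (p C suc k) _ pp p∣C*)
    where
    k≤p = ℕₚ.<⇒≤ 1+k<p
    C*≡p! : (p C suc k) ℕ.* (suc k ! ℕ.* (p ∸ suc k) !) ≡ p !
    C*≡p! = trans (cong (ℕ._* (suc k ! ℕ.* (p ∸ suc k) !)) (nCk≡n!/k![n-k]! k≤p))
      (m/n*n≡m {{(suc k) ℕₚ.!* (p ∸ suc k) !≢0}} (k![n∸k]!∣n! k≤p))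
    p∣C* : p ℕD.∣ (p C suc k) ℕ.* (suc k ! ℕ.* (p ∸ suc k) !)
    p∣C* = subst (p ℕD.∣_) (sym C*≡p!) (n∣n! p {{prime⇒nonZero pp}})
    p∤ : ¬ p ℕD.∣ suc k ! ℕ.* (p ∸ suc k) !
    p∤ d = [ prime∤! pp (suc k) 1+k<p , prime∤! pp (p ∸ suc k) (ℕₚ.∸-monoʳ-< (s≤s z≤n) k≤p) ]′
      (euclidsLemma (suc k !) _ pp d)

  nC0≡1 : ∀ n → n C 0 ≡ 1
  nC0≡1 n = trans (nCk≡nC[n∸k] {0} {n} z≤n) (nCn≡1 n)

  -- Since S = 1 + Δ for the shift S, this is the Frobenius identity (1 + Δ)^p = 1 + Δ^p.
  frobenius : ∀ {p} → Prime p → ∀ m f y → Δ^ p m f y ≡[ p ] Δ (+ p * m) f y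
  frobenius {zero} pp = contradiction (prime⇒1< pp) λ ()
  frobenius {suc q} pp m f y = ∣⇒≡[] (subst (+ suc q ∣_) (sym expand) (∣m⇒∣-m (Σ<-∣ q {g = λ k → + (suc q C suc k) * a (suc k)}
      (λ k k<q → ∣m⇒∣m*n (a (suc k)) (∣ᵤ⇒∣ {+ suc q} {+ (suc q C suc k)} (prime∣C pp k (s≤s k<q)))))))
    where
    open ≡-Reasoning
    a : ℕ → ℤ
    a k = Δ^ k m f y
    middle = Σ< q (λ k → + (suc q C suc k) * a (suc k))
    f[y+pm] : f (y + + suc q * m) ≡ a 0 + (middle + a (suc q))
    f[y+pm] = begin
      f (y + + suc q * m)
        ≡⟨ newton (suc q) m f y ⟩
      + (suc q C 0) * a 0 + Σ< (suc q) (λ k → + (suc q C suc k) * a (suc k))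
        ≡⟨ cong₂ (λ c s → + c * a 0 + s) (nC0≡1 (suc q)) (Σ<-last q _) ⟩
      1ℤ * a 0 + (middle + + (suc q C suc q) * a (suc q))
        ≡⟨ cong (λ c → 1ℤ * a 0 + (middle + + c * a (suc q))) (nCn≡1 (suc q)) ⟩
      1ℤ * a 0 + (middle + 1ℤ * a (suc q))
        ≡⟨ cong₂ (λ u v → u + (middle + v)) (ℤₚ.*-identityˡ (a 0)) (ℤₚ.*-identityˡ (a (suc q))) ⟩
      a 0 + (middle + a (suc q)) ∎
    collapse : ∀ u v w → w - ((u + (v + w)) - u) ≡ - v
    collapse = solve-∀
    expand : a (suc q) - (f (y + + suc q * m) - f y) ≡ - middle
    expand = trans (cong (λ t → a (suc q) - (t - f y)) f[y+pm]) (collapse (a 0) middle (a (suc q)))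

  -- Raises an operator congruence to the `j`-th power. The hypothesis is asked for every `f`
  -- because the induction replaces `f` by `Δ^ n m f`.
  Δ^-multiple : ∀ {p} n m m′ → (∀ f y → Δ^ n m f y ≡[ p ] Δ m′ f y) →
    ∀ j f y → Δ^ (j ℕ.* n) m f y ≡[ p ] Δ^ j m′ f y
  Δ^-multiple n m m′ e zero    f y = ≡⇒≡[] refl
  Δ^-multiple n m m′ e (suc j) f y =
    ≡[]-trans (≡⇒≡[] (cong (λ g → g y) (Δ^-+ n (j ℕ.* n) m f)))
    (≡[]-trans (Δ^-multiple n m m′ e j (Δ^ n m f) y)
               (Δ^-resp j m′ (e f) y))

  -- Induction on `e`: the `p`-th power of the congruence for `e` turns the left side into `p`
  -- differences of step `p ^ e`, and `frobenius` makes these one difference of step `p · p ^ e`.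
  frobenius-power : ∀ {p} → Prime p → ∀ e f y → Δ^ (p ^ e) 1ℤ f y ≡[ p ] Δ (+ (p ^ e)) f y
  frobenius-power pp zero f y = ≡⇒≡[] refl
  frobenius-power {p} pp (suc e) f y =
    ≡[]-trans (Δ^-multiple (p ^ e) 1ℤ (+ (p ^ e)) (frobenius-power pp e) p f y)
    (≡[]-trans (frobenius pp (+ (p ^ e)) f y)
               (≡⇒≡[] (cong (λ m → Δ m f y) (sym (ℤₚ.pos-* p (p ^ e))))))

  -- Degree less than n modulo p, with polynomial functions described by their differences.
  LowDegree : ℕ → ℕ → (ℤ → ℤ) → Set
  LowDegree p n f = ∀ y → + p ∣ Δ^ n 1ℤ f y

  module _ {p : ℕ} where

    LowDegree-resp : ∀ n {f g} → (∀ y → f y ≡[ p ] g y) → LowDegree p n f → LowDegree p n g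
    LowDegree-resp n e d y = ≡[]-∣ (Δ^-resp n 1ℤ e y) (d y)

    LowDegree-mono : ∀ m n f → LowDegree p m f → LowDegree p (m ℕ.+ n) f
    LowDegree-mono m zero    f d = subst (λ k → LowDegree p k f) (sym (ℕₚ.+-identityʳ m)) d
    LowDegree-mono m (suc n) f d = subst (λ k → LowDegree p k f) (sym (ℕₚ.+-suc m n))
      (λ y → subst (+ p ∣_) (sym (Δ^-Δ (m ℕ.+ n) 1ℤ f y))
        (∣m∣n⇒∣m-n (LowDegree-mono m n f d (y + 1ℤ)) (LowDegree-mono m n f d y)))

    LowDegree-mono-≤ : ∀ {m n} → m ≤ n → ∀ f → LowDegree p m f → LowDegree p n f
    LowDegree-mono-≤ {m} {n} m≤n f d = subst (λ k → LowDegree p k f) (ℕₚ.m+[n∸m]≡n m≤n)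
      (LowDegree-mono m (n ∸ m) f d)

    LowDegree-- : ∀ n f g → LowDegree p n f → LowDegree p n g → LowDegree p n (λ y → f y - g y)
    LowDegree-- zero    f g d e y = ∣m∣n⇒∣m-n (d y) (e y)
    LowDegree-- (suc n) f g d e = LowDegree-resp n
      (λ y → ≡⇒≡[] (swap (f (y + 1ℤ)) (f y) (g (y + 1ℤ)) (g y)))
      (LowDegree-- n (Δ 1ℤ f) (Δ 1ℤ g) d e)
      where
      swap : ∀ a b c d → (a - b) - (c - d) ≡ (a - c) - (b - d)
      swap = solve-∀

    LowDegree-shift : ∀ n m f → LowDegree p n f → LowDegree p n (λ y → f (y + m))
    LowDegree-shift zero    m f d y = d (y + m)
    LowDegree-shift (suc n) m f d = LowDegree-resp n
      (λ y → ≡⇒≡[] (cong (λ z → f z - f (y + m)) (swap y m)))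
      (LowDegree-shift n m (Δ 1ℤ f) d)
      where
      swap : ∀ y m → (y + m) + 1ℤ ≡ (y + 1ℤ) + m
      swap = solve-∀

    LowDegree-Δ : ∀ n m f → LowDegree p n f → LowDegree p n (Δ m f)
    LowDegree-Δ n m f d = LowDegree-- n (λ y → f (y + m)) f (LowDegree-shift n m f d) d

    -- The steps `a` for which `Δ a f` has low degree form a subgroup of the integers, because
    -- `Δ (a - b) f` at `y` is `Δ a f - Δ b f` at `y - b`.
    LowDegree-Δ-multiple : ∀ n m f → LowDegree p n (Δ m f) → ∀ t → LowDegree p n (Δ (t * m) f)
    LowDegree-Δ-multiple n m f d = multiple
      where
      minus : ∀ a b → LowDegree p n (Δ a f) → LowDegree p n (Δ b f) → LowDegree p n (Δ (a - b) f)
      minus a b da db = LowDegree-resp n (λ y → ≡⇒≡[] (lemma y))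
        (LowDegree-- n (λ y → Δ a f (y - b)) (λ y → Δ b f (y - b))
          (LowDegree-shift n (- b) (Δ a f) da) (LowDegree-shift n (- b) (Δ b f) db))
        where
        telescope : ∀ u v w → (u - v) - (w - v) ≡ u - w
        telescope = solve-∀
        back : ∀ y b → (y - b) + b ≡ y
        back = solve-∀
        forth : ∀ y a b → (y - b) + a ≡ y + (a - b)
        forth = solve-∀
        lemma : ∀ y → Δ a f (y - b) - Δ b f (y - b) ≡ Δ (a - b) f y
        lemma y = trans (telescope (f (y - b + a)) (f (y - b)) (f (y - b + b)))
          (cong₂ (λ u v → f u - f v) (forth y a b) (back y b))
      Δ0 : LowDegree p n (Δ 0ℤ f)
      Δ0 = LowDegree-resp n (λ y → ≡⇒≡[] (lemma y)) (LowDegree-- n (Δ m f) (Δ m f) d d)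
        where
        lemma : ∀ y → Δ m f y - Δ m f y ≡ f (y + 0ℤ) - f y
        lemma y = trans (ℤₚ.+-inverseʳ (Δ m f y))
          (sym (trans (cong (λ z → f z - f y) (ℤₚ.+-identityʳ y)) (ℤₚ.+-inverseʳ (f y))))
      retag : ∀ {a b} → a ≡ b → LowDegree p n (Δ a f) → LowDegree p n (Δ b f)
      retag = subst (λ a → LowDegree p n (Δ a f))
      negative : ∀ k → LowDegree p n (Δ (- (+ k) * m) f)
      negative zero    = Δ0
      negative (suc k) = retag (lemma (+ k) m) (minus (- (+ k) * m) m (negative k) d)
        where
        lemma : ∀ k m → - k * m - m ≡ - (1ℤ + k) * m
        lemma = solve-∀
      multiple : ∀ t → LowDegree p n (Δ (t * m) f)
      multiple (-[1+ k ]) = negative (suc k)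
      multiple (+ k) = retag (lemma (+ k) m) (minus 0ℤ (- (+ k) * m) Δ0 (negative k))
        where
        lemma : ∀ k m → 0ℤ - - k * m ≡ k * m
        lemma = solve-∀

    -- Modulo `p` a difference of step `p ^ e` is `p ^ e` differences of step 1, so it lowers the
    -- degree by `p ^ e`. This is the source of the weights `p ^ e s`.
    LowDegree-Δ-prime-power : Prime p → ∀ n e f → LowDegree p n f →
      ∀ {m} → + (p ^ e) ∣ m → LowDegree p (n ∸ p ^ e) (Δ m f)
    LowDegree-Δ-prime-power pp n e f d (divides t refl) =
      LowDegree-Δ-multiple (n ∸ p ^ e) (+ (p ^ e)) f
        (LowDegree-resp (n ∸ p ^ e) (frobenius-power pp e f) low) t
      where
      low : LowDegree p (n ∸ p ^ e) (Δ^ (p ^ e) 1ℤ f)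
      low y = subst (λ g → + p ∣ g y) (Δ^-+ (p ^ e) (n ∸ p ^ e) 1ℤ f) (mono y)
        where
        -- If `n < p ^ e`, truncated subtraction gives 0; the bound is first raised to `p ^ e`, and
        -- the difference then vanishes modulo `p`.
        mono : LowDegree p (p ^ e ℕ.+ (n ∸ p ^ e)) f
        mono = LowDegree-mono-≤ (ℕₚ.m≤n+m∸n n (p ^ e)) f d

  -- Indicator functions of the multiples of a number

  δ : ℕ → ℤ → ℤ
  δ d y with + d ∣? y
  ... | yes _ = 1ℤ
  ... | no  _ = 0ℤ

  δ-∣ : ∀ {d y} → + d ∣ y → δ d y ≡ 1ℤ
  δ-∣ {d} {y} d∣y with + d ∣? y
  ... | yes _ = refl
  ... | no ¬d = contradiction d∣y ¬d

  δ-∤ : ∀ {d y} → ¬ + d ∣ y → δ d y ≡ 0ℤ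
  δ-∤ {d} {y} d∤y with + d ∣? y
  ... | yes d∣y = contradiction d∣y d∤y
  ... | no  _ = refl

  δ-period : ∀ {d m} y → + d ∣ m → δ d (y + m) ≡ δ d y
  δ-period {d} {m} y d∣m with + d ∣? y
  ... | yes d∣y = δ-∣ (∣m∣n⇒∣m+n d∣y d∣m)
  ... | no  d∤y = δ-∤ (λ d∣y+m → d∤y (∣m+n∣n⇒∣m d∣y+m d∣m))

  -- By `frobenius-power`, `p ^ e` unit differences amount to one difference of step `p ^ e`, which
  -- is a period of the indicator.
  δ-lowDegree : ∀ {p} → Prime p → ∀ e → LowDegree p (p ^ e) (δ (p ^ e))
  δ-lowDegree {p} pp e y = ≡[]-∣ (≡[]-sym (frobenius-power pp e (δ (p ^ e)) y))
    (≡[]⇒∣ (≡⇒≡[] (δ-period {p ^ e} {+ (p ^ e)} y (divides 1ℤ (sym (ℤₚ.*-identityˡ (+ (p ^ e))))))))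

  -- Functions on the cube of subsets, and their weighted degree modulo p

  ∂ : ∀ {k} → (Subset (suc k) → ℤ) → Subset k → ℤ
  ∂ f I = f (true ∷ I) - f (false ∷ I)

  -- The sum of `(-1)^(k - |I|) f I` over all `I`, that is, the coefficient of the full product when
  -- `f` is written as a multilinear polynomial.
  alternating : ∀ k → (Subset k → ℤ) → ℤ
  alternating zero    f = f []
  alternating (suc k) f = alternating k (∂ f)

  alternating-cong : ∀ k {f g : Subset k → ℤ} → (∀ I → f I ≡ g I) → alternating k f ≡ alternating k g
  alternating-cong zero    e = e []
  alternating-cong (suc k) e = alternating-cong k (λ I → cong₂ _-_ (e (true ∷ I)) (e (false ∷ I)))

  alternating-- : ∀ k f g → alternating k (λ I → f I - g I) ≡ alternating k f - alternating k g
  alternating-- zero    f g = refl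
  alternating-- (suc k) f g = trans
    (alternating-cong k (λ I → swap (f (true ∷ I)) (g (true ∷ I)) (f (false ∷ I)) (g (false ∷ I))))
    (alternating-- k (∂ f) (∂ g))
    where
    swap : ∀ a b c d → (a - b) - (c - d) ≡ (a - c) - (b - d)
    swap = solve-∀

  alternating-0 : ∀ k → alternating k (λ _ → 0ℤ) ≡ 0ℤ
  alternating-0 zero    = refl
  alternating-0 (suc k) = alternating-0 k

  alternating-+ : ∀ k f g → alternating k (λ I → f I + g I) ≡ alternating k f + alternating k g
  alternating-+ k f g = begin
    alternating k (λ I → f I + g I)
      ≡⟨ alternating-cong k (λ I → lemma (f I) (g I)) ⟩
    alternating k (λ I → f I - (0ℤ - g I))
      ≡⟨ alternating-- k f (λ I → 0ℤ - g I) ⟩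
    alternating k f - alternating k (λ I → 0ℤ - g I)
      ≡⟨ cong (_-_ (alternating k f)) (alternating-- k (λ _ → 0ℤ) g) ⟩
    alternating k f - (alternating k (λ _ → 0ℤ) - alternating k g)
      ≡⟨ cong (λ z → alternating k f - (z - alternating k g)) (alternating-0 k) ⟩
    alternating k f - (0ℤ - alternating k g)
      ≡⟨ sym (lemma (alternating k f) (alternating k g)) ⟩
    alternating k f + alternating k g ∎
    where
    open ≡-Reasoning
    lemma : ∀ a b → a + b ≡ a - (0ℤ - b)
    lemma = solve-∀

  alternating-Σ< : ∀ {d} k n (F : ℕ → Subset k → ℤ) → (∀ x → d ∣ alternating k (F x)) →
    d ∣ alternating k (λ I → Σ< n (λ x → F x I))
  alternating-Σ< {d} k zero F e = subst (d ∣_) (sym (alternating-0 k)) (k∣0 d)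
  alternating-Σ< {d} k (suc n) F e = subst (d ∣_) (sym (alternating-+ k (F 0) (λ I → Σ< n (λ x → F (suc x) I))))
    (∣m∣n⇒∣m+n (e 0) (alternating-Σ< k n (F ∘ suc) (e ∘ suc)))

  alternating-witness : ∀ {d} k (f : Subset k → ℤ) → ¬ d ∣ alternating k f → ∃ λ I → ¬ d ∣ f I
  alternating-witness zero    f d∤ = [] , d∤
  alternating-witness {d} (suc k) f d∤ with alternating-witness k (∂ f) d∤
  ... | I , d∤∂f with d ∣? f (true ∷ I)
  ...   | no  d∤f₁ = true ∷ I , d∤f₁
  ...   | yes d∣f₁ = false ∷ I , λ d∣f₀ → d∤∂f (∣m∣n⇒∣m-n d∣f₁ d∣f₀)

  -- If the subsets containing the first index have an alternating sum not divisible by `d`, one of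
  -- them is a witness; otherwise the remaining subsets again have a divisible alternating sum, and
  -- the induction continues with them.
  nonempty-witness : ∀ {d} k (f : Subset k → ℤ) → ¬ d ∣ f ∅ → d ∣ alternating k f →
    ∃ λ I → Nonempty I × ¬ d ∣ f I
  nonempty-witness zero    f d∤f∅ d∣alt = contradiction d∣alt d∤f∅
  nonempty-witness {d} (suc k) f d∤f∅ d∣alt with d ∣? alternating k (f ∘ (true ∷_))
  ... | no d∤alt₁ = let I , d∤f₁ = alternating-witness k (f ∘ (true ∷_)) d∤alt₁
                    in true ∷ I , (zero , here) , d∤f₁
  ... | yes d∣alt₁ = let I , (s , s∈I) , d∤f₀ = nonempty-witness k (f ∘ (false ∷_)) d∤f∅ d∣alt₀
                     in false ∷ I , (suc s , there s∈I) , d∤f₀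
    where
    lemma : ∀ u v → u - (u - v) ≡ v
    lemma = solve-∀
    d∣alt₀ : d ∣ alternating k (f ∘ (false ∷_))
    d∣alt₀ = subst (d ∣_) (lemma (alternating k (f ∘ (true ∷_))) (alternating k (f ∘ (false ∷_))))
      (∣m∣n⇒∣m-n d∣alt₁ (subst (d ∣_) (alternating-- k (f ∘ (true ∷_)) (f ∘ (false ∷_))) d∣alt))

  -- In multilinear coordinates f = Σ_J c_J Π_{s∈J} x_s, this says that p divides c_J
  -- for every J of weight at least n; so n plays the role of degree + 1.
  LowWeight : ℕ → ∀ k → (Fin k → ℕ) → ℕ → (Subset k → ℤ) → Set
  LowWeight p zero    w zero    f = + p ∣ f []
  LowWeight p zero    w (suc n) f = ⊤
  LowWeight p (suc k) w n       f =
    LowWeight p k (w ∘ suc) n (f ∘ (false ∷_)) × LowWeight p k (w ∘ suc) (n ∸ w zero) (∂ f)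

  total : ∀ k → (Fin k → ℕ) → ℕ
  total zero    w = 0
  total (suc k) w = w zero ℕ.+ total k (w ∘ suc)

  module _ {p : ℕ} where

    LowWeight-resp : ∀ k {w n f g} → (∀ I → f I ≡ g I) → LowWeight p k w n f → LowWeight p k w n g
    LowWeight-resp zero {n = zero}  e d = subst (+ p ∣_) (e []) d
    LowWeight-resp zero {n = suc n} e d = tt
    LowWeight-resp (suc k) e (d₀ , d∂) =
      LowWeight-resp k (λ I → e (false ∷ I)) d₀ ,
      LowWeight-resp k (λ I → cong₂ _-_ (e (true ∷ I)) (e (false ∷ I))) d∂

    LowWeight-vanishing : ∀ k {w n f} → (∀ I → + p ∣ f I) → LowWeight p k w n f
    LowWeight-vanishing zero {n = zero}  e = e []
    LowWeight-vanishing zero {n = suc n} e = tt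
    LowWeight-vanishing (suc k) e =
      LowWeight-vanishing k (λ I → e (false ∷ I)) ,
      LowWeight-vanishing k (λ I → ∣m∣n⇒∣m-n (e (true ∷ I)) (e (false ∷ I)))

    -- Bound 0 makes every coefficient divisible by `p`, hence every value. It is used when
    -- truncated subtraction has brought a bound down to 0.
    vanishing-LowWeight : ∀ k {w f} → LowWeight p k w 0 f → ∀ I → + p ∣ f I
    vanishing-LowWeight zero    d [] = d
    vanishing-LowWeight (suc k) (d₀ , d∂) (false ∷ I) = vanishing-LowWeight k d₀ I
    vanishing-LowWeight (suc k) {w} {f} (d₀ , d∂) (true ∷ I) =
      subst (+ p ∣_) (lemma (f (true ∷ I)) (f (false ∷ I)))
        (∣m∣n⇒∣m+n (vanishing-LowWeight k (subst (λ n → LowWeight p k (w ∘ suc) n (∂ f)) (ℕₚ.0∸n≡0 (w zero)) d∂) I)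
                   (vanishing-LowWeight k d₀ I))
      where
      lemma : ∀ u v → (u - v) + v ≡ u
      lemma = solve-∀

    LowWeight-mono : ∀ k {w m n f} → m ≤ n → LowWeight p k w m f → LowWeight p k w n f
    LowWeight-mono zero {n = zero}  z≤n d = d
    LowWeight-mono zero {n = suc n} m≤n d = tt
    LowWeight-mono (suc k) {w} m≤n (d₀ , d∂) =
      LowWeight-mono k m≤n d₀ , LowWeight-mono k (ℕₚ.∸-monoˡ-≤ (w zero) m≤n) d∂

    LowWeight-+ : ∀ k {w n f g} → LowWeight p k w n f → LowWeight p k w n g →
      LowWeight p k w n (λ I → f I + g I)
    LowWeight-+ zero {n = zero}  d e = ∣m∣n⇒∣m+n d e
    LowWeight-+ zero {n = suc n} d e = tt
    LowWeight-+ (suc k) {f = f} {g} (d₀ , d∂) (e₀ , e∂) =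
      LowWeight-+ k d₀ e₀ ,
      LowWeight-resp k (λ I → swap (f (true ∷ I)) (f (false ∷ I)) (g (true ∷ I)) (g (false ∷ I)))
        (LowWeight-+ k d∂ e∂)
      where
      swap : ∀ a b c d → (a - b) + (c - d) ≡ (a + c) - (b + d)
      swap = solve-∀

    -- The case split for the bound of a difference: either it is still a successor, so that an
    -- induction hypothesis applies, or it is 0 and the difference vanishes modulo `p`.
    suc-∸ : ∀ a w → (w ≤ a × suc a ∸ w ≡ suc (a ∸ w)) ⊎ (suc a ∸ w ≡ 0)
    suc-∸ a w with w ℕ.≤? a
    ... | yes w≤a = inj₁ (w≤a , ℕₚ.+-∸-assoc 1 w≤a)
    ... | no  w≰a = inj₂ (ℕₚ.m≤n⇒m∸n≡0 (ℕₚ.≰⇒> w≰a))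

    -- The Leibniz rule ∂(f g) = ∂f g₁ + f₀ ∂g.
    LowWeight-* : ∀ k {w} a b {f g} → LowWeight p k w (suc a) f → LowWeight p k w (suc b) g →
      LowWeight p k w (suc (a ℕ.+ b)) (λ I → f I * g I)
    LowWeight-* zero    a b d e = tt
    LowWeight-* (suc k) {w} a b {f} {g} (d₀ , d∂) (e₀ , e∂) =
      LowWeight-* k a b d₀ e₀ ,
      LowWeight-resp k leibniz (LowWeight-+ k ∂f*g₁ f₀*∂g)
      where
      f₀ f₁ g₀ g₁ : Subset k → ℤ
      f₀ I = f (false ∷ I)
      f₁ I = f (true ∷ I)
      g₀ I = g (false ∷ I)
      g₁ I = g (true ∷ I)
      leibniz : ∀ I → ∂ f I * g₁ I + f₀ I * ∂ g I ≡ f₁ I * g₁ I - f₀ I * g₀ I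
      leibniz I = lemma (f₁ I) (f₀ I) (g₁ I) (g₀ I)
        where
        lemma : ∀ a b c d → (a - b) * c + b * (c - d) ≡ a * c - b * d
        lemma = solve-∀
      -- `g₁` is the sum of `∂ g` and `g₀`, and the smaller bound of `∂ g` may be relaxed to that of
      -- `g₀`.
      e₁ : LowWeight p k (w ∘ suc) (suc b) g₁
      e₁ = LowWeight-resp k (λ I → lemma (g₁ I) (g₀ I))
        (LowWeight-+ k (LowWeight-mono k (ℕₚ.m∸n≤m (suc b) (w zero)) e∂) e₀)
        where
        lemma : ∀ u v → (u - v) + v ≡ u
        lemma = solve-∀
      n = suc (a ℕ.+ b) ∸ w zero
      ∂f*g₁ : LowWeight p k (w ∘ suc) n (λ I → ∂ f I * g₁ I)
      ∂f*g₁ with suc-∸ a (w zero)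
      ... | inj₂ ≡0 = LowWeight-vanishing k (λ I → ∣m⇒∣m*n (g₁ I)
        (vanishing-LowWeight k (subst (λ n → LowWeight p k (w ∘ suc) n (∂ f)) ≡0 d∂) I))
      ... | inj₁ (w≤a , ≡suc) = subst (λ n → LowWeight p k (w ∘ suc) n (λ I → ∂ f I * g₁ I)) arith
        (LowWeight-* k (a ∸ w zero) b (subst (λ n → LowWeight p k (w ∘ suc) n (∂ f)) ≡suc d∂) e₁)
        where
        arith : suc (a ∸ w zero ℕ.+ b) ≡ n
        arith = trans (cong (ℕ._+ b) (sym ≡suc)) (sym (ℕₚ.+-∸-comm b (ℕₚ.m≤n⇒m≤1+n w≤a)))
      f₀*∂g : LowWeight p k (w ∘ suc) n (λ I → f₀ I * ∂ g I)
      f₀*∂g with suc-∸ b (w zero)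
      ... | inj₂ ≡0 = LowWeight-vanishing k (λ I → ∣n⇒∣m*n (f₀ I)
        (vanishing-LowWeight k (subst (λ n → LowWeight p k (w ∘ suc) n (∂ g)) ≡0 e∂) I))
      ... | inj₁ (w≤b , ≡suc) = subst (λ n → LowWeight p k (w ∘ suc) n (λ I → f₀ I * ∂ g I)) arith
        (LowWeight-* k a (b ∸ w zero) d₀ (subst (λ n → LowWeight p k (w ∘ suc) n (∂ g)) ≡suc e∂))
        where
        arith : suc (a ℕ.+ (b ∸ w zero)) ≡ n
        arith = sym (ℕₚ.+-∸-assoc (suc a) w≤b)

    -- The alternating sum is the coefficient of the full index set, whose weight is `total k w`.
    LowWeight-alternating : ∀ k {w n f} → n ≤ total k w → LowWeight p k w n f → + p ∣ alternating k f
    LowWeight-alternating zero    z≤n d = d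
    LowWeight-alternating (suc k) {w} {n} n≤ (d₀ , d∂) =
      LowWeight-alternating k (ℕₚ.m≤n+o⇒m∸n≤o n (w zero) n≤) d∂

    -- An index set of `w`-weight above `W n` has `u`-weight above `n`, so its coefficient is
    -- already divisible by `p`.
    LowWeight-rescale : ∀ k W {u w} → (∀ s → w s ≤ W ℕ.* u s) → ∀ n {f} →
      LowWeight p k u (suc n) f → LowWeight p k w (suc (W ℕ.* n)) f
    LowWeight-rescale zero    W w≤Wu n d = tt
    LowWeight-rescale (suc k) W {u} {w} w≤Wu n {f} (d₀ , d∂) = LowWeight-rescale k W (w≤Wu ∘ suc) n d₀ , ∂-case
      where
      ∂-case : LowWeight p k (w ∘ suc) (suc (W ℕ.* n) ∸ w zero) (∂ f)
      ∂-case with suc-∸ n (u zero)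
      ... | inj₂ ≡0 = LowWeight-vanishing k
        (vanishing-LowWeight k (subst (λ n → LowWeight p k (u ∘ suc) n (∂ f)) ≡0 d∂))
      ... | inj₁ (u≤n , ≡suc) = LowWeight-mono k bound
        (LowWeight-rescale k W (w≤Wu ∘ suc) (n ∸ u zero)
          (subst (λ n → LowWeight p k (u ∘ suc) n (∂ f)) ≡suc d∂))
        where
        open ℕₚ.≤-Reasoning
        bound : suc (W ℕ.* (n ∸ u zero)) ≤ suc (W ℕ.* n) ∸ w zero
        bound = begin
          suc (W ℕ.* (n ∸ u zero))            ≡⟨ cong suc (ℕₚ.*-distribˡ-∸ W n (u zero)) ⟩
          suc (W ℕ.* n ∸ W ℕ.* u zero)        ≡⟨ sym (ℕₚ.+-∸-assoc 1 (ℕₚ.*-monoʳ-≤ W u≤n)) ⟩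
          suc (W ℕ.* n) ∸ W ℕ.* u zero        ≤⟨ ℕₚ.∸-monoʳ-≤ (suc (W ℕ.* n)) (w≤Wu zero) ⟩
          suc (W ℕ.* n) ∸ w zero              ∎

    -- Along the subset sum, `∂` in coordinate `s` becomes a difference of step `M s`; `step`
    -- records that this lowers the degree by `w s`.
    LowDegree-pullback : ∀ k {w : Fin k → ℕ} (M : Fin k → ℤ) →
      (∀ s n f → LowDegree p n f → LowDegree p (n ∸ w s) (Δ (M s) f)) →
      ∀ n f → LowDegree p n f → ∀ y → LowWeight p k w n (λ I → f (y + subsetSum _+_ 0ℤ I M))
    LowDegree-pullback zero M step zero    f d y = d (y + 0ℤ)
    LowDegree-pullback zero M step (suc n) f d y = tt
    LowDegree-pullback (suc k) {w} M step n f d y =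
      LowDegree-pullback k (M ∘ suc) (step ∘ suc) n f d y ,
      LowWeight-resp k (λ I → cong (λ z → f z - f (y + subsetSum _+_ 0ℤ I (M ∘ suc))) (swap y (M zero) _))
        (LowDegree-pullback k (M ∘ suc) (step ∘ suc) (n ∸ w zero) (Δ (M zero) f) (step zero n f d) y)
      where
      swap : ∀ y m s → (y + s) + m ≡ y + (m + s)
      swap = solve-∀

    -- A coordinate of nonzero weight does not affect the value, so only monomials in coordinates of
    -- weight 0 occur: the weighted degree is 0.
    periodic-pullback : ∀ k {w : Fin k → ℕ} (M : Fin k → ℤ) (f : ℤ → ℤ) →
      (∀ s → w s ≡ 0 ⊎ (∀ y → f (y + M s) ≡ f y)) →
      ∀ y → LowWeight p k w 1 (λ I → f (y + subsetSum _+_ 0ℤ I M))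
    periodic-pullback zero M f per y = tt
    periodic-pullback (suc k) {w} M f per y = periodic-pullback k (M ∘ suc) f (per ∘ suc) y , ∂-case (per zero)
      where
      swap : ∀ y m s → (y + s) + m ≡ y + (m + s)
      swap = solve-∀
      ∂f≡ : ∀ I → Δ (M zero) f (y + subsetSum _+_ 0ℤ I (M ∘ suc)) ≡ ∂ (λ I → f (y + subsetSum _+_ 0ℤ I M)) I
      ∂f≡ I = cong (λ z → f z - f (y + subsetSum _+_ 0ℤ I (M ∘ suc))) (swap y (M zero) _)
      Δ-per : ∀ s → w (suc s) ≡ 0 ⊎ (∀ y → Δ (M zero) f (y + M (suc s)) ≡ Δ (M zero) f y)
      Δ-per s with per (suc s)
      ... | inj₁ w≡0 = inj₁ w≡0
      ... | inj₂ e   = inj₂ λ y → cong₂ _-_ (trans (cong f (comm y (M (suc s)) (M zero))) (e (y + M zero))) (e y)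
        where
        comm : ∀ y a b → (y + a) + b ≡ (y + b) + a
        comm = solve-∀
      ∂-case : w zero ≡ 0 ⊎ (∀ y → f (y + M zero) ≡ f y) →
        LowWeight p k (w ∘ suc) (1 ∸ w zero) (∂ (λ I → f (y + subsetSum _+_ 0ℤ I M)))
      ∂-case (inj₁ w≡0) = subst (λ v → LowWeight p k (w ∘ suc) (1 ∸ v) (∂ (λ I → f (y + subsetSum _+_ 0ℤ I M)))) (sym w≡0)
        (LowWeight-resp k ∂f≡ (periodic-pullback k (M ∘ suc) (Δ (M zero) f) Δ-per y))
      ∂-case (inj₂ e) = LowWeight-vanishing k λ I → subst (+ p ∣_)
        (trans (sym (ℤₚ.+-inverseʳ (f (y + subsetSum _+_ 0ℤ I (M ∘ suc)))))
          (trans (cong (_- f (y + subsetSum _+_ 0ℤ I (M ∘ suc))) (sym (e _))) (∂f≡ I)))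
        (k∣0 (+ p))

  -- Auxiliary facts on sums, Bézout coefficients and factorials

  Σ<-- : ∀ n g h → Σ< n (λ k → g k - h k) ≡ Σ< n g - Σ< n h
  Σ<-- zero    g h = refl
  Σ<-- (suc n) g h = trans (cong (_+_ (g 0 - h 0)) (Σ<-- n (g ∘ suc) (h ∘ suc)))
    (lemma (g 0) (h 0) (Σ< n (g ∘ suc)) (Σ< n (h ∘ suc)))
    where
    lemma : ∀ a b c d → (a - b) + (c - d) ≡ (a + c) - (b + d)
    lemma = solve-∀

  bézout⇒ℤ : ∀ g y b x a → g ℕ.+ y ℕ.* b ≡ x ℕ.* a → + g ≡ + x * + a + - (+ y * + b)
  bézout⇒ℤ g y b x a eq = begin
    + g                              ≡⟨ lemma (+ g) (+ y * + b) ⟩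
    (+ g + + y * + b) - + y * + b    ≡⟨ cong (λ z → (+ g + z) - + y * + b) (sym (ℤₚ.pos-* y b)) ⟩
    + (g ℕ.+ y ℕ.* b) - + y * + b    ≡⟨ cong (λ z → + z - + y * + b) eq ⟩
    + (x ℕ.* a) - + y * + b          ≡⟨ cong (_- + y * + b) (ℤₚ.pos-* x a) ⟩
    + x * + a - + y * + b            ∎
    where
    open ≡-Reasoning
    lemma : ∀ u v → u ≡ (u + v) - v
    lemma = solve-∀

  support-step : ∀ N j y → + N ∣ y * + (j !) → + N ∣ y * + (suc j !)
  support-step N j y N∣ = subst (+ N ∣_)
    (trans (lemma y (+ (j !)) (+ suc j)) (cong (_*_ y) (sym (ℤₚ.pos-* (suc j) (j !)))))
    (∣m⇒∣m*n (+ suc j) N∣)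
    where
    lemma : ∀ y f q → y * f * q ≡ y * (q * f)
    lemma = solve-∀

  -- A substitute for a primitive character of ℤ/N

  Period : ℤ → (ℤ → ℤ) → Set
  Period m f = ∀ y → f (y + m) ≡ f y

  module _ {f : ℤ → ℤ} where

    Period-0 : Period 0ℤ f
    Period-0 y = cong f (ℤₚ.+-identityʳ y)

    Period-+ : ∀ {a b} → Period a f → Period b f → Period (a + b) f
    Period-+ {a} {b} p q y = trans (cong f (sym (ℤₚ.+-assoc y a b))) (trans (q (y + a)) (p y))

    Period-neg : ∀ {a} → Period a f → Period (- a) f
    Period-neg {a} p y = trans (sym (p (y + - a))) (cong f (lemma y a))
      where
      lemma : ∀ y a → (y + - a) + a ≡ y
      lemma = solve-∀

    Period-*ℕ : ∀ {a} → Period a f → ∀ n → Period (+ n * a) f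
    Period-*ℕ {a} p zero    = subst (λ m → Period m f) (sym (ℤₚ.*-zeroˡ a)) Period-0
    Period-*ℕ {a} p (suc n) = subst (λ m → Period m f) (lemma (+ n) a) (Period-+ p (Period-*ℕ p n))
      where
      lemma : ∀ n a → a + n * a ≡ (1ℤ + n) * a
      lemma = solve-∀

    Period-* : ∀ {a} → Period a f → ∀ t → Period (t * a) f
    Period-* p (+ n)    = Period-*ℕ p n
    Period-* {a} p -[1+ n ] = subst (λ m → Period m f) (ℤₚ.neg-distribˡ-* (+ suc n) a)
      (Period-neg (Period-*ℕ p (suc n)))

    Period-∣ : ∀ {a m} → Period a f → a ∣ m → Period m f
    Period-∣ p (divides t refl) = Period-* p t

    -- Periods form a subgroup of the integers, so Bézout's identity applies.
    Period-gcd : ∀ a b → Period (+ a) f → Period (+ b) f → Period (+ gcd a b) f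
    Period-gcd a b p q with Bézout.identity (gcd-GCD a b)
    ... | Bézout.+- x y eq = subst (λ m → Period m f) (sym (bézout⇒ℤ (gcd a b) y b x a eq))
      (Period-+ (Period-*ℕ p x) (Period-neg (Period-*ℕ q y)))
    ... | Bézout.-+ x y eq = subst (λ m → Period m f) (sym (bézout⇒ℤ (gcd a b) x a y b eq))
      (Period-+ (Period-*ℕ q y) (Period-neg (Period-*ℕ p x)))

  -- For `f` of period `N` this is `N` times the mean of `f` over the coset of `y` modulo the
  -- subgroup generated by `i` in the integers modulo `N`; leaving out the division keeps it
  -- integral.
  average : ℕ → ℤ → (ℤ → ℤ) → ℤ → ℤ
  average N i f y = Σ< N (λ x → f (y - + x * i))

  average-Δ : ∀ N i r f y → average N i (λ z → f z - f (z + r)) y ≡ average N i f y - average N i f (y + r)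
  average-Δ N i r f y = trans (Σ<-- N (λ x → f (y - + x * i)) (λ x → f (y - + x * i + r)))
    (cong (_-_ (average N i f y)) (Σ<-cong N (λ x → cong f (swap y (+ x * i) r))))
    where
    swap : ∀ y a r → y - a + r ≡ y + r - a
    swap = solve-∀

  average-Period : ∀ N i m f → Period m f → Period m (average N i f)
  average-Period N i m f per y = Σ<-cong N (λ x → trans (cong f (swap y m (+ x * i))) (per _))
    where
    swap : ∀ y m a → y + m - a ≡ y - a + m
    swap = solve-∀

  -- Moving `y` by `i` shifts the range of summation by one, and the two end terms agree because
  -- their arguments differ by a multiple of `N`.
  average-Period-step : ∀ N i f → Period (+ N) f → Period i (average N i f)
  average-Period-step N i f per y = ∙-cancelˡ (F 0) _ _ (begin
    F 0 + Σ< N F                      ≡⟨ ℤₚ.+-comm (F 0) (Σ< N F) ⟩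
    Σ< N F + F 0                      ≡⟨ cong (_+_ (Σ< N F)) (sym FN≡F0) ⟩
    Σ< N F + F N                      ≡⟨ sym (Σ<-last N F) ⟩
    F 0 + Σ< N (F ∘ suc)              ≡⟨ cong (_+_ (F 0)) (Σ<-cong N (λ x → cong f (shift y i (+ x)))) ⟩
    F 0 + average N i f y             ∎)
    where
    open ≡-Reasoning
    F : ℕ → ℤ
    F x = f (y + i - + x * i)
    shift : ∀ y i x → y + i - (1ℤ + x) * i ≡ y - x * i
    shift = solve-∀
    FN≡F0 : F N ≡ F 0
    FN≡F0 = trans (cong f (lemma (y + i) (+ N) i))
      (trans (Period-* {f} per (- i) _) (cong f (lemma₀ (y + i) i)))
      where
      lemma : ∀ z n i → z - n * i ≡ z + - i * n
      lemma = solve-∀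
      lemma₀ : ∀ z i → z ≡ z - 0ℤ * i
      lemma₀ = solve-∀

  -- The stage at which the primes up to `j` have been treated. `averages` is the gain so far;
  -- `support` guarantees that treating the next prime leaves the value at 0 unchanged.
  record Sieved (N j : ℕ) : Set where
    field
      fun      : ℤ → ℤ
      period   : Period (+ N) fun
      fun0≡1   : fun 0ℤ ≡ 1ℤ
      support  : ∀ y → ¬ + N ∣ y * + (j !) → fun y ≡ 0ℤ
      averages : ∀ {q} → Prime q → q ≤ j → ∀ r → N ≡ r ℕ.* q →
                 ∀ i → gcd ℤ.∣ i ∣ N ℕD.∣ r → ∀ y → average N i fun y ≡ 0ℤ

  sieve : ∀ N → .{{NonZero N}} → ∀ j → Sieved N j
  sieve N zero = record
    { fun      = δ N
    ; period   = λ y → δ-period {N} {+ N} y (divides 1ℤ (sym (ℤₚ.*-identityˡ (+ N))))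
    ; fun0≡1   = δ-∣ {N} {0ℤ} (k∣0 (+ N))
    ; support  = λ y N∤y → δ-∤ {N} {y} (λ N∣y → N∤y (∣m⇒∣m*n 1ℤ N∣y))
    ; averages = λ q-prime q≤0 → contradiction (ℕₚ.≤-trans (prime⇒1< q-prime) q≤0) λ ()
    }
  sieve N (suc j) with sieve N j | prime? (suc j) | suc j ℕD.∣? N
  ... | S | no ¬prime | _ = record
    { fun      = fun
    ; period   = period
    ; fun0≡1   = fun0≡1
    ; support  = λ y N∤ → support y (λ N∣ → N∤ (support-step N j y N∣))
    ; averages = λ q-prime q≤1+j r N≡rq → averages q-prime (below q-prime q≤1+j) r N≡rq
    }
    where
    open Sieved S
    below : ∀ {q} → Prime q → q ≤ suc j → q ≤ j
    below q-prime q≤1+j = ℕₚ.≤-pred (ℕₚ.≤∧≢⇒< q≤1+j λ where refl → ¬prime q-prime)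
  ... | S | yes _ | no 1+j∤N = record
    { fun      = fun
    ; period   = period
    ; fun0≡1   = fun0≡1
    ; support  = λ y N∤ → support y (λ N∣ → N∤ (support-step N j y N∣))
    ; averages = λ q-prime q≤1+j r N≡rq → averages q-prime (below q≤1+j r N≡rq) r N≡rq
    }
    where
    open Sieved S
    below : ∀ {q} → q ≤ suc j → ∀ r → N ≡ r ℕ.* q → q ≤ j
    below q≤1+j r N≡rq = ℕₚ.≤-pred (ℕₚ.≤∧≢⇒< q≤1+j λ where refl → 1+j∤N (ℕD.divides r N≡rq))
  -- Only a prime divisor `1 + j` of `N` changes the function: `1 - S^r` is applied with
  -- `r = N / (1 + j)`.
  ... | S | yes 1+j-prime | yes (ℕD.divides r N≡r[1+j]) = record
    { fun      = λ y → fun y - fun (y + + r)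
    ; period   = λ y → cong₂ _-_ (period y) (trans (cong fun (swap y (+ N) (+ r))) (period (y + + r)))
    ; fun0≡1   = cong₂ _-_ fun0≡1 (support (+ r) N∤rj!)
    ; support  = λ y N∤ → cong₂ _-_ (support y (λ N∣ → N∤ (support-step N j y N∣)))
                                     (support (y + + r) (λ N∣ → N∤ (shifted y N∣)))
    ; averages = avg
    }
    where
    open Sieved S
    swap : ∀ y a b → y + a + b ≡ y + b + a
    swap = solve-∀
    instance
      r≢0 : NonZero r
      r≢0 = ℕₚ.m*n≢0⇒m≢0 r {{subst NonZero N≡r[1+j] it}}
    -- Since `N = r (1 + j)`, the contrary would make the prime `1 + j` divide `j !`. Hence the old
    -- function vanishes at `r` and the new one is still 1 at 0.
    N∤rj! : ¬ + N ∣ + r * + (j !)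
    N∤rj! N∣rj! = prime∤! 1+j-prime j (ℕₚ.n<1+n j)
      (ℕD.*-cancelˡ-∣ r (subst₂ ℕD._∣_ N≡r[1+j] (ℤₚ.abs-* (+ r) (+ (j !))) (∣⇒∣ᵤ N∣rj!)))
    shifted : ∀ y → + N ∣ (y + + r) * + (j !) → + N ∣ y * + (suc j !)
    shifted y N∣ = subst (+ N ∣_) eq (∣m∣n⇒∣m-n (∣m⇒∣m*n (+ suc j) N∣) (∣n⇒∣m*n (+ (j !)) N∣r[1+j]))
      where
      N∣r[1+j] : + N ∣ + r * + suc j
      N∣r[1+j] = subst (+ N ∣_) (trans (cong +_ N≡r[1+j]) (ℤₚ.pos-* r (suc j))) (divides 1ℤ (sym (ℤₚ.*-identityˡ (+ N))))
      lemma : ∀ y r f q → (y + r) * f * q - f * (r * q) ≡ y * (q * f)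
      lemma = solve-∀
      eq : (y + + r) * + (j !) * + suc j - + (j !) * (+ r * + suc j) ≡ y * + (suc j !)
      eq = trans (lemma y (+ r) (+ (j !)) (+ suc j)) (cong (_*_ y) (sym (ℤₚ.pos-* (suc j) (j !))))
    avg : ∀ {q} → Prime q → q ≤ suc j → ∀ s → N ≡ s ℕ.* q →
      ∀ i → gcd ℤ.∣ i ∣ N ℕD.∣ s → ∀ y → average N i (λ y → fun y - fun (y + + r)) y ≡ 0ℤ
    avg {q} q-prime q≤1+j s N≡sq i g∣s y with q ℕ.≟ suc j
    ... | no q≢1+j = trans (average-Δ N i (+ r) fun y) (cong₂ _-_ (avg₀ y) (avg₀ (y + + r)))
      where
      avg₀ = averages q-prime (ℕₚ.≤-pred (ℕₚ.≤∧≢⇒< q≤1+j q≢1+j)) s N≡sq i g∣s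
    -- The old average has periods `i` and `N`, hence their gcd, which divides `r`; its values at
    -- `y` and `y + r` therefore cancel.
    ... | yes refl = trans (average-Δ N i (+ r) fun y)
      (trans (cong (_-_ (average N i fun y)) (period-r y)) (ℤₚ.+-inverseʳ (average N i fun y)))
      where
      W = average N i fun
      period-∣i∣ : Period (+ ℤ.∣ i ∣) W
      period-∣i∣ = Period-∣ (average-Period-step N i fun period) (m∣∣m∣ {i})
      period-r : Period (+ r) W
      period-r = Period-∣ (Period-gcd ℤ.∣ i ∣ N period-∣i∣ (average-Period N i (+ N) fun period))
        (∣ᵤ⇒∣ (subst (gcd ℤ.∣ i ∣ N ℕD.∣_) (ℕₚ.*-cancelʳ-≡ s r (suc j) (trans (sym N≡sq) N≡r[1+j])) g∣s))

  prime-factor : ∀ t → .{{NonZero t}} → ¬ t ≡ 1 → ∃ λ q → Prime q × q ℕD.∣ t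
  prime-factor t t≢1 with factorise t
  ... | record { factors = []    ; isFactorisation = t≡1 } = contradiction t≡1 t≢1
  ... | record { factors = q ∷ qs ; isFactorisation = t≡Π ; factorsPrime = q-prime ∷ _ } =
    q , q-prime , subst (q ℕD.∣_) (sym t≡Π) (ℕD.m∣m*n (product qs))

  -- This replaces a primitive N-th root of unity. The witness is obtained from the indicator of N ℤ by
  -- applying 1 - S^(N/q) for each prime q ∣ N, where S is the shift.
  record PrimitiveFunction (N : ℕ) : Set where
    field
      fun     : ℤ → ℤ
      period  : Period (+ N) fun
      fun0≡1  : fun 0ℤ ≡ 1ℤ
      average≡0 : ∀ i → ¬ + N ∣ i → ∀ y → average N i fun y ≡ 0ℤ

  primitiveFunction : ∀ N → .{{NonZero N}} → PrimitiveFunction N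
  primitiveFunction N = record { fun = fun ; period = period ; fun0≡1 = fun0≡1 ; average≡0 = average≡0 }
    where
    open Sieved (sieve N N)
    average≡0 : ∀ i → ¬ + N ∣ i → ∀ y → average N i fun y ≡ 0ℤ
    average≡0 i N∤i with gcd[m,n]∣n ℤ.∣ i ∣ N
    -- Here `t = N / gcd(i, N)` is not 1 because `N` does not divide `i`. For a prime `q` dividing
    -- `t`, the gcd divides `N / q`, as `averages` demands.
    ... | ℕD.divides t N≡tg with prime-factor t {{ℕₚ.m*n≢0⇒m≢0 t {{subst NonZero N≡tg it}}}} t≢1
      where
      t≢1 : ¬ t ≡ 1
      t≢1 refl = N∤i (∣ᵤ⇒∣ (subst (ℕD._∣ ℤ.∣ i ∣) (sym (trans N≡tg (ℕₚ.*-identityˡ _))) (gcd[m,n]∣m ℤ.∣ i ∣ N)))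
    ...   | q , q-prime , ℕD.divides t′ t≡t′q =
      averages q-prime (ℕD.∣⇒≤ (ℕD.divides (t′ ℕ.* g) N≡t′gq)) (t′ ℕ.* g) N≡t′gq i (ℕD.n∣m*n t′)
      where
      g = gcd ℤ.∣ i ∣ N
      N≡t′gq : N ≡ t′ ℕ.* g ℕ.* q
      N≡t′gq = begin
        N                ≡⟨ N≡tg ⟩
        t ℕ.* g          ≡⟨ cong (ℕ._* g) t≡t′q ⟩
        t′ ℕ.* q ℕ.* g   ≡⟨ ℕₚ.*-assoc t′ q g ⟩
        t′ ℕ.* (q ℕ.* g) ≡⟨ cong (t′ ℕ.*_) (ℕₚ.*-comm q g) ⟩
        t′ ℕ.* (g ℕ.* q) ≡⟨ sym (ℕₚ.*-assoc t′ g q) ⟩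
        t′ ℕ.* g ℕ.* q   ∎
        where open ≡-Reasoning

  -- Separating the p-part of the moduli

  -- `N` is coprime to `p ^ e`; Euclid's lemma removes one factor `p` of `d` at a time.
  prime∤⇒∣-cancel : ∀ {p} → Prime p → ∀ {N} → ¬ p ℕD.∣ N → ∀ e d → p ^ e ℕD.∣ N ℕ.* d → p ^ e ℕD.∣ d
  prime∤⇒∣-cancel pp p∤N zero    d _ = ℕD.1∣ d
  prime∤⇒∣-cancel {p} pp {N} p∤N (suc e) d p^∣Nd
    with euclidsLemma N d pp (ℕD.∣-trans (ℕD.m∣m*n (p ^ e)) p^∣Nd)
  ... | inj₁ p∣N = contradiction p∣N p∤N
  ... | inj₂ (ℕD.divides d′ refl) = subst (p ^ suc e ℕD.∣_) (ℕₚ.*-comm p d′)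
    (ℕD.*-monoʳ-∣ p (prime∤⇒∣-cancel pp p∤N e d′
      (ℕD.*-cancelˡ-∣ p {{prime⇒nonZero pp}} (subst (p ^ suc e ℕD.∣_) (lemma N d′ p) p^∣Nd))))
    where
    lemma : ∀ N d p → N ℕ.* (d ℕ.* p) ≡ p ℕ.* (N ℕ.* d)
    lemma = ℕSolver.solve-∀

  p-part : ∀ {p} → Prime p → ∀ n → .{{NonZero n}} → ∃ λ n′ → ∃ λ u → n ≡ n′ ℕ.* p ^ u × ¬ p ℕD.∣ n′
  p-part {p} pp n = bounded n n ℕₚ.≤-refl
    where
    bounded : ∀ b n → .{{NonZero n}} → n ≤ b → ∃ λ n′ → ∃ λ u → n ≡ n′ ℕ.* p ^ u × ¬ p ℕD.∣ n′
    bounded zero    n n≤0 = contradiction n≤0 (ℕₚ.<⇒≱ (ℕ.>-nonZero⁻¹ n))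
    bounded (suc b) n n≤1+b with p ℕD.∣? n
    ... | no p∤n = n , 0 , sym (ℕₚ.*-identityʳ n) , p∤n
    ... | yes (ℕD.divides m n≡mp) =
      let n′ , u , m≡ , p∤n′ = bounded b m {{m≢0}} (ℕₚ.≤-pred (ℕₚ.≤-trans m<n n≤1+b))
      in n′ , suc u , trans n≡mp (trans (cong (ℕ._* p) m≡) (lemma n′ (p ^ u) p)) , p∤n′
      where
      m≢0 : NonZero m
      m≢0 = ℕₚ.m*n≢0⇒m≢0 m {{subst NonZero n≡mp it}}
      m<n : m < n
      m<n = subst (m <_) (sym n≡mp) (ℕₚ.m<m*n m p {{m≢0}} (prime⇒1< pp))
      lemma : ∀ a b c → a ℕ.* b ℕ.* c ≡ a ℕ.* (c ℕ.* b)
      lemma = ℕSolver.solve-∀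

  -- N · p^v is a common multiple of the n s = n′ s · p^(u s), with quotients t s · p^(e s).
  record Separation (p k : ℕ) (n : Fin k → ℕ) : Set where
    field
      N v      : ℕ
      p∤N      : ¬ p ℕD.∣ N
      n′ t u e : Fin k → ℕ
      n≡       : ∀ s → n s ≡ n′ s ℕ.* p ^ u s
      N≡       : ∀ s → N ≡ n′ s ℕ.* t s
      v≡       : ∀ s → v ≡ e s ℕ.+ u s

  separate : ∀ {p} → Prime p → ∀ k (n : Fin k → ℕ) → (∀ s → NonZero (n s)) → Separation p k n
  separate pp zero n npos = record
    { N = 1 ; v = 0 ; p∤N = λ p∣1 → ℕₚ.<⇒≱ (prime⇒1< pp) (ℕD.∣⇒≤ p∣1)
    ; n′ = λ () ; t = λ () ; u = λ () ; e = λ () ; n≡ = λ () ; N≡ = λ () ; v≡ = λ () }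
  separate {p} pp (suc k) n npos
    with p-part pp (n zero) {{npos zero}} | separate pp k (n ∘ suc) (npos ∘ suc)
  ... | n₀ , u₀ , n≡₀ , p∤n₀ | S = record
    -- The prime-to-`p` parts are multiplied and the exponents added, instead of forming a least
    -- common multiple; the cofactors `t` and `e` are then explicit.
    { N = n₀ ℕ.* N
    ; v = v ℕ.+ u₀
    ; p∤N = λ p∣ → [ p∤n₀ , p∤N ]′ (euclidsLemma n₀ N pp p∣)
    ; n′ = λ { zero → n₀ ; (suc s) → n′ s }
    ; t = λ { zero → N ; (suc s) → n₀ ℕ.* t s }
    ; u = λ { zero → u₀ ; (suc s) → u s }
    ; e = λ { zero → v ; (suc s) → u₀ ℕ.+ e s }
    ; n≡ = λ { zero → n≡₀ ; (suc s) → n≡ s }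
    ; N≡ = λ { zero → refl ; (suc s) → trans (cong (n₀ ℕ.*_) (N≡ s)) (swap n₀ (n′ s) (t s)) }
    ; v≡ = λ { zero → refl ; (suc s) → trans (cong (ℕ._+ u₀) (v≡ s)) (rotate (e s) (u s) u₀) }
    }
    where
    open Separation S
    swap : ∀ a b c → a ℕ.* (b ℕ.* c) ≡ b ℕ.* (a ℕ.* c)
    swap = ℕSolver.solve-∀
    rotate : ∀ a b c → a ℕ.+ b ℕ.+ c ≡ c ℕ.+ a ℕ.+ b
    rotate = ℕSolver.solve-∀

  -- Counting in arithmetic progressions

  indicator : ∀ {ℓ} {P : Set ℓ} → Dec P → ℕ
  indicator P? = if does P? then 1 else 0

  length-filter-tabulate : ∀ {a ℓ} {A : Set a} {P : Pred A ℓ} (P? : Decidable P) k (f : Fin k → A) →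
    length (filter P? (tabulate f)) ≡ total k (indicator ∘ P? ∘ f)
  length-filter-tabulate P? zero    f = refl
  length-filter-tabulate P? (suc k) f with does (P? (f zero))
  ... | true  = cong suc (length-filter-tabulate P? k (f ∘ suc))
  ... | false = length-filter-tabulate P? k (f ∘ suc)

  count : ℕ → (ℕ → ℕ) → ℕ
  count zero    g = 0
  count (suc n) g = g 0 ℕ.+ count n (g ∘ suc)

  count-+ : ∀ m n g → count (m ℕ.+ n) g ≡ count m g ℕ.+ count n (g ∘ (m ℕ.+_))
  count-+ zero    n g = refl
  count-+ (suc m) n g = trans (cong (g 0 ℕ.+_) (count-+ m n (g ∘ suc)))
    (sym (ℕₚ.+-assoc (g 0) (count m (g ∘ suc)) _))

  count-mono : ∀ n {g h : ℕ → ℕ} → (∀ x → g x ≤ h x) → count n g ≤ count n h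
  count-mono zero    e = z≤n
  count-mono (suc n) e = ℕₚ.+-mono-≤ (e 0) (count-mono n (e ∘ suc))

  count-const : ∀ n c → count n (λ _ → c) ≡ n ℕ.* c
  count-const zero    c = refl
  count-const (suc n) c = cong (c ℕ.+_) (count-const n c)

  -- The range splits into `E` blocks of `Q` consecutive numbers. The hypothesis covers every
  -- starting point `o`, so it survives the shift in the induction.
  count-blocks : ∀ E Q (g : ℕ → ℕ) → (∀ o → count Q (λ x → g (o ℕ.+ x)) ≤ 1) → count (E ℕ.* Q) g ≤ E
  count-blocks zero    Q g block≤1 = z≤n
  count-blocks (suc E) Q g block≤1 = ℕₚ.≤-trans (ℕₚ.≤-reflexive (count-+ Q (E ℕ.* Q) g))
    (ℕₚ.+-mono-≤ (block≤1 0) (count-blocks E Q (g ∘ (Q ℕ.+_)) λ o →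
      ℕₚ.≤-trans (count-mono Q (λ x → ℕₚ.≤-reflexive (cong g (sym (ℕₚ.+-assoc Q o x))))) (block≤1 (Q ℕ.+ o))))

  count-indicator-0 : ∀ n {ℓ} {P : ℕ → Set ℓ} (P? : ∀ x → Dec (P x)) →
    (∀ x → x < n → ¬ P x) → count n (λ x → indicator (P? x)) ≡ 0
  count-indicator-0 zero    P? ¬P = refl
  count-indicator-0 (suc n) P? ¬P with P? 0
  ... | yes P0 = contradiction P0 (¬P 0 (s≤s z≤n))
  ... | no _   = count-indicator-0 n (P? ∘ suc) (λ x x<n → ¬P (suc x) (s≤s x<n))

  count-indicator-1 : ∀ n {ℓ} {P : ℕ → Set ℓ} (P? : ∀ x → Dec (P x)) →
    (∀ x y → x < y → y < n → P x → ¬ P y) → count n (λ x → indicator (P? x)) ≤ 1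
  count-indicator-1 zero    P? exclusive = z≤n
  count-indicator-1 (suc n) P? exclusive with P? 0
  ... | yes P0 = ℕₚ.≤-reflexive (cong suc (count-indicator-0 n (P? ∘ suc)
                   (λ x x<n → exclusive 0 (suc x) (s≤s z≤n) (s≤s x<n) P0)))
  ... | no _ = count-indicator-1 n (P? ∘ suc) (λ x y x<y y<n → exclusive (suc x) (suc y) (s≤s x<y) (s≤s y<n))

  total-0 : ∀ k → total k (λ _ → 0) ≡ 0
  total-0 zero    = refl
  total-0 (suc k) = total-0 k

  total-+ : ∀ k f g → total k (λ s → f s ℕ.+ g s) ≡ total k f ℕ.+ total k g
  total-+ zero    f g = refl
  total-+ (suc k) f g = trans (cong (f zero ℕ.+ g zero ℕ.+_) (total-+ k (f ∘ suc) (g ∘ suc)))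
    (swap (f zero) (g zero) (total k (f ∘ suc)) (total k (g ∘ suc)))
    where
    swap : ∀ a b c d → a ℕ.+ b ℕ.+ (c ℕ.+ d) ≡ a ℕ.+ c ℕ.+ (b ℕ.+ d)
    swap = ℕSolver.solve-∀

  total-mono : ∀ k {f g : Fin k → ℕ} → (∀ s → f s ≤ g s) → total k f ≤ total k g
  total-mono zero    e = z≤n
  total-mono (suc k) e = ℕₚ.+-mono-≤ (e zero) (total-mono k (e ∘ suc))

  count-total : ∀ n k (g : ℕ → Fin k → ℕ) → count n (λ x → total k (g x)) ≡ total k (λ s → count n (λ x → g x s))
  count-total zero    k g = sym (total-0 k)
  count-total (suc n) k g = trans (cong (total k (g 0) ℕ.+_) (count-total n k (g ∘ suc)))
    (sym (total-+ k (g 0) (λ s → count n (λ x → g (suc x) s))))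

  module Covering {p k : ℕ} {n : Fin k → ℕ} (pp : Prime p) (S : Separation p k n) (a : Fin k → ℤ) where
    open Separation S

    weight : ℤ → Fin k → ℕ
    weight x s = indicator (n′ s ℕD.∣? ℤ.∣ x - a s ∣) ℕ.* p ^ e s

    hits? : ∀ x s (y : ℕ) → Dec (n s ℕD.∣ ℤ.∣ x + + y * + N - a s ∣)
    hits? x s y = n s ℕD.∣? ℤ.∣ x + + y * + N - a s ∣

    -- Among the integers `x + y N` with `y < p ^ v`, class `s` can occur only if `n′ s` divides
    -- `x - a s`, and then at most once in any `p ^ u s` consecutive values of `y`.
    count-class : ∀ x s → count (p ^ v) (indicator ∘ hits? x s) ≤ weight x s
    count-class x s with n′ s ℕD.∣? ℤ.∣ x - a s ∣
    ... | no n′∤ = ℕₚ.≤-reflexive (count-indicator-0 (p ^ v) (hits? x s) λ y _ n∣ → n′∤ (∣⇒∣ᵤ (residue y n∣)))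
      where
      residue : ∀ y → n s ℕD.∣ ℤ.∣ x + + y * + N - a s ∣ → + n′ s ∣ x - a s
      residue y n∣ = ∣m+n∣n⇒∣m (subst (+ n′ s ∣_) (swap x (+ y * + N) (a s)) n′∣) (∣n⇒∣m*n (+ y) n′∣N)
        where
        n′∣ : + n′ s ∣ x + + y * + N - a s
        n′∣ = ∣-trans (∣ᵤ⇒∣ {+ n′ s} {+ n s} (subst (n′ s ℕD.∣_) (sym (n≡ s)) (ℕD.m∣m*n (p ^ u s))))
          (∣ᵤ⇒∣ {+ n s} {x + + y * + N - a s} n∣)
        n′∣N : + n′ s ∣ + N
        n′∣N = ∣ᵤ⇒∣ {+ n′ s} {+ N} (subst (n′ s ℕD.∣_) (sym (N≡ s)) (ℕD.m∣m*n (t s)))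
        swap : ∀ x y a → x + y - a ≡ (x - a) + y
        swap = solve-∀
    ... | yes _ = subst₂ _≤_
      (cong (λ m → count m (indicator ∘ hits? x s)) (sym p^v≡))
      (sym (ℕₚ.+-identityʳ (p ^ e s)))
      (count-blocks (p ^ e s) (p ^ u s) _ λ o → count-indicator-1 (p ^ u s) (λ y → hits? x s (o ℕ.+ y)) (exclusive o))
      where
      p^v≡ : p ^ v ≡ p ^ e s ℕ.* p ^ u s
      p^v≡ = trans (cong (p ^_) (v≡ s)) (ℕₚ.^-distribˡ-+-* p (e s) (u s))
      -- Two hits would give `p ^ u s ∣ N (z - y)`, hence `p ^ u s ∣ z - y` as `p` does not divide
      -- `N`, although `0 < z - y < p ^ u s`.
      exclusive : ∀ o y z → y < z → z < p ^ u s →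
        n s ℕD.∣ ℤ.∣ x + + (o ℕ.+ y) * + N - a s ∣ → ¬ n s ℕD.∣ ℤ.∣ x + + (o ℕ.+ z) * + N - a s ∣
      exclusive o y z y<z z<p^u n∣y n∣z = ℕₚ.<⇒≱ (ℕₚ.≤-<-trans (ℕₚ.m∸n≤m z y) z<p^u)
        (ℕD.∣⇒≤ {{ℕ.>-nonZero (ℕₚ.m<n⇒0<n∸m y<z)}} (prime∤⇒∣-cancel pp p∤N (u s) (z ∸ y) (∣⇒∣ᵤ p^u∣)))
        where
        p^u∣n : + (p ^ u s) ∣ + n s
        p^u∣n = ∣ᵤ⇒∣ {+ (p ^ u s)} {+ n s} (subst (p ^ u s ℕD.∣_) (sym (n≡ s)) (ℕD.n∣m*n (n′ s)))
        open ≡-Reasoning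
        lemma : ∀ x a o y d N → (x + (o + (y + d)) * N - a) - (x + (o + y) * N - a) ≡ N * d
        lemma = solve-∀
        difference : (x + + (o ℕ.+ z) * + N - a s) - (x + + (o ℕ.+ y) * + N - a s) ≡ + (N ℕ.* (z ∸ y))
        difference = begin
          (x + + (o ℕ.+ z) * + N - a s) - (x + + (o ℕ.+ y) * + N - a s)
            ≡⟨ cong (λ z → (x + + (o ℕ.+ z) * + N - a s) - (x + + (o ℕ.+ y) * + N - a s)) (sym (ℕₚ.m+[n∸m]≡n (ℕₚ.<⇒≤ y<z))) ⟩
          (x + (+ o + (+ y + + (z ∸ y))) * + N - a s) - (x + (+ o + + y) * + N - a s)
            ≡⟨ lemma x (a s) (+ o) (+ y) (+ (z ∸ y)) (+ N) ⟩
          + N * + (z ∸ y)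
            ≡⟨ sym (ℤₚ.pos-* N (z ∸ y)) ⟩
          + (N ℕ.* (z ∸ y)) ∎
        p^u∣ : + (p ^ u s) ∣ + (N ℕ.* (z ∸ y))
        p^u∣ = ∣-trans p^u∣n (subst (+ n s ∣_) difference (∣m∣n⇒∣m-n
          (∣ᵤ⇒∣ {+ n s} {x + + (o ℕ.+ z) * + N - a s} n∣z) (∣ᵤ⇒∣ {+ n s} {x + + (o ℕ.+ y) * + N - a s} n∣y)))

    -- Double counting of the pairs `(y, s)` with `x + y N` in class `s`: the cover gives at least
    -- `p ^ v · m`, and `count-class` at most the total weight.
    weight-bound : ∀ {m} → IsMCover m k a n → ∀ x → p ^ v ℕ.* m ≤ total k (weight x)
    weight-bound {m} cover x = begin
      p ^ v ℕ.* m
        ≡⟨ sym (count-const (p ^ v) m) ⟩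
      count (p ^ v) (λ _ → m)
        ≤⟨ count-mono (p ^ v) (λ y → cover (x + + y * + N)) ⟩
      count (p ^ v) (λ y → coveringFunction k a n (x + + y * + N))
        ≤⟨ count-mono (p ^ v) (λ y → ℕₚ.≤-reflexive (length-filter-tabulate (λ s → hits? x s y) k id)) ⟩
      count (p ^ v) (λ y → total k (λ s → indicator (hits? x s y)))
        ≡⟨ count-total (p ^ v) k (λ y s → indicator (hits? x s y)) ⟩
      total k (λ s → count (p ^ v) (indicator ∘ hits? x s))
        ≤⟨ total-mono k (count-class x) ⟩
      total k (weight x) ∎
      where open ℕₚ.≤-Reasoning

  -- Subset sums and finite products

  ΣI : ∀ {k} → Subset k → (Fin k → ℤ) → ℤ
  ΣI = subsetSum _+_ 0ℤ

  subsetSum-∅ : ∀ {a} {A : Set a} (_+_ : A → A → A) e k (f : Fin k → A) → subsetSum _+_ e ∅ f ≡ e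
  subsetSum-∅ _+_ e zero    f = refl
  subsetSum-∅ _+_ e (suc k) f = subsetSum-∅ _+_ e k (f ∘ suc)

  -- As `x` varies, this sum runs through an arithmetic progression of step `ΣI I M`, so summing a
  -- function of it over `x` yields an `average`.
  ΣI-affine : ∀ {k} (I : Subset k) (a M : Fin k → ℤ) x →
    ΣI I (λ s → (a s - x) * M s) ≡ ΣI I (λ s → a s * M s) - x * ΣI I M
  ΣI-affine [] a M x = lemma x
    where
    lemma : ∀ x → 0ℤ ≡ 0ℤ - x * 0ℤ
    lemma = solve-∀
  ΣI-affine (false ∷ I) a M x = ΣI-affine I (a ∘ suc) (M ∘ suc) x
  ΣI-affine (true ∷ I)  a M x = trans
    (cong (_+_ ((a zero - x) * M zero)) (ΣI-affine I (a ∘ suc) (M ∘ suc) x))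
    (lemma (a zero) (M zero) x _ _)
    where
    lemma : ∀ a m x A B → (a - x) * m + (A - x * B) ≡ (a * m + A) - x * (m + B)
    lemma = solve-∀

  Σ<-*ʳ : ∀ n g c → Σ< n (λ x → g x * c) ≡ Σ< n g * c
  Σ<-*ʳ zero    g c = sym (ℤₚ.*-zeroˡ c)
  Σ<-*ʳ (suc n) g c = trans (cong (_+_ (g 0 * c)) (Σ<-*ʳ n (g ∘ suc) c))
    (sym (ℤₚ.*-distribʳ-+ c (g 0) (Σ< n (g ∘ suc))))

  Σ<-1 : ∀ n → Σ< n (λ _ → 1ℤ) ≡ + n
  Σ<-1 zero    = refl
  Σ<-1 (suc n) = cong (_+_ 1ℤ) (Σ<-1 n)

  total-*ˡ : ∀ k c f → total k (λ s → c ℕ.* f s) ≡ c ℕ.* total k f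
  total-*ˡ zero    c f = sym (ℕₚ.*-zeroʳ c)
  total-*ˡ (suc k) c f = trans (cong (c ℕ.* f zero ℕ.+_) (total-*ˡ k c (f ∘ suc)))
    (sym (ℕₚ.*-distribˡ-+ c (f zero) (total k (f ∘ suc))))

  ∏ : ∀ r → (Fin r → ℤ) → ℤ
  ∏ zero    g = 1ℤ
  ∏ (suc r) g = g zero * ∏ r (g ∘ suc)

  ∏-1 : ∀ r {g : Fin r → ℤ} → (∀ i → g i ≡ 1ℤ) → ∏ r g ≡ 1ℤ
  ∏-1 zero    e = refl
  ∏-1 (suc r) e = cong₂ _*_ (e zero) (∏-1 r (e ∘ suc))

  ∏-0 : ∀ r {g : Fin r → ℤ} i → g i ≡ 0ℤ → ∏ r g ≡ 0ℤ
  ∏-0 (suc r) {g} zero    e = trans (cong (_* ∏ r (g ∘ suc)) e) (ℤₚ.*-zeroˡ (∏ r (g ∘ suc)))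
  ∏-0 (suc r) {g} (suc i) e = trans (cong (_*_ (g zero)) (∏-0 r i e)) (ℤₚ.*-zeroʳ (g zero))

  ∏-LowWeight : ∀ {p} k {w} r (d : Fin r → ℕ) (F : Fin r → Subset k → ℤ) →
    (∀ i → LowWeight p k w (suc (d i)) (F i)) → LowWeight p k w (suc (total r d)) (λ I → ∏ r (λ i → F i I))
  -- The empty product is the constant 1, of weighted degree 0; steps equal to 0 express it as a
  -- pullback.
  ∏-LowWeight k zero    d F low = periodic-pullback k (λ _ → 0ℤ) (λ _ → 1ℤ) (λ _ → inj₂ λ _ → refl) 0ℤ
  ∏-LowWeight k (suc r) d F low = LowWeight-* k (d zero) (total r (d ∘ suc)) (low zero)
    (∏-LowWeight k r (d ∘ suc) (F ∘ suc) (low ∘ suc))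

  -- The detecting function

  module Detector {p k : ℕ} {n : Fin k → ℕ} (pp : Prime p) (S : Separation p k n) (a : Fin k → ℤ) (m : Fin k → ℤ)
           (h r : ℕ) (f : Fin r → ℕ) (γ : Fin k → Fin r → ℤ)
           (cover : IsMCover (total r (λ i → p ^ f i ∸ 1) ℕ.+ p ^ h) k a n) where
    open Separation S
    open Covering pp S a

    private
      instance
        N≢0 : NonZero N
        N≢0 = ℕ.≢-nonZero λ where refl → p∤N (p ℕD.∣0)

        p≢0 : NonZero p
        p≢0 = prime⇒nonZero pp

      q : ℕ
      q = p ^ (v ℕ.+ h)

      open PrimitiveFunction (primitiveFunction N) renaming (fun to ε)

      d : Fin r → ℕ
      d i = p ^ f i ∸ 1

    -- The integer `(m s / n s) · N p^v`; see `M-scale`.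
    M : Fin k → ℤ
    M s = m s * + t s * + (p ^ e s)

    -- The part independent of `x`. The terms `0ℤ +` are the base point `y` of the pullback lemmas.
    rest : Subset k → ℤ
    rest I = δ q (0ℤ + ΣI I M) * ∏ r (λ i → δ (p ^ f i) (0ℤ + ΣI I (λ s → γ s i)))

    summand : ℤ → Subset k → ℤ
    summand x I = ε (0ℤ + ΣI I (λ s → (a s - x) * M s)) * rest I

    -- `M s` is a multiple of `p ^ e s`, which is the weight in the nonzero case; in the other case
    -- the degree need only not increase.
    M-step : ∀ x s g n → LowDegree p n g → LowDegree p (n ∸ weight x s) (Δ (M s) g)
    M-step x s g n low with n′ s ℕD.∣? ℤ.∣ x - a s ∣
    ... | no _  = LowDegree-Δ n (M s) g low
    ... | yes _ = subst (λ w → LowDegree p (n ∸ w) (Δ (M s) g)) (sym (ℕₚ.+-identityʳ (p ^ e s)))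
      (LowDegree-Δ-prime-power pp n (e s) g low (divides (m s * + t s) refl))

    -- If `n′ s` divides `x - a s`, then `N = n′ s · t s` divides `(a s - x) M s`, because `M s`
    -- contains the factor `t s`.
    ε-step : ∀ x s → weight x s ≡ 0 ⊎ Period ((a s - x) * M s) ε
    ε-step x s with n′ s ℕD.∣? ℤ.∣ x - a s ∣
    ... | no _ = inj₁ refl
    ... | yes n′∣ = inj₂ (Period-∣ period (∣-trans N∣ (divides (- (m s * + (p ^ e s))) (lemma x (a s) (m s) (+ t s) (+ (p ^ e s))))))
      where
      N∣ : + N ∣ (x - a s) * + t s
      N∣ = subst (_∣ (x - a s) * + t s) (trans (sym (ℤₚ.pos-* (n′ s) (t s))) (cong +_ (sym (N≡ s))))
        (*-monoˡ-∣ (+ t s) (∣ᵤ⇒∣ {+ n′ s} {x - a s} n′∣))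
      lemma : ∀ x a m t p → (a - x) * (m * t * p) ≡ - (m * p) * ((x - a) * t)
      lemma = solve-∀

    weight≤ : ∀ x s → weight x s ≤ p ^ v ℕ.* 1
    weight≤ x s with n′ s ℕD.∣? ℤ.∣ x - a s ∣
    ... | no _ = z≤n
    ... | yes _ = subst₂ _≤_ (sym (ℕₚ.+-identityʳ (p ^ e s))) (sym (ℕₚ.*-identityʳ (p ^ v)))
      (ℕₚ.^-monoʳ-≤ p (subst (e s ≤_) (sym (v≡ s)) (ℕₚ.m≤m+n (e s) (u s))))

    -- With all weights equal to 1 the degree is at most `p ^ f i - 1`; the actual weights are at
    -- most `p ^ v`, so rescaling multiplies this by `p ^ v`.
    coordinate-low : ∀ x i → LowWeight p k (weight x) (suc (p ^ v ℕ.* d i)) (λ I → δ (p ^ f i) (0ℤ + ΣI I (λ s → γ s i)))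
    coordinate-low x i = LowWeight-rescale k (p ^ v) {λ _ → 1} (weight≤ x) (d i)
      (LowDegree-pullback k (λ s → γ s i)
        -- The exponent 0 stands for the uniform weight `p ^ 0 = 1`: any step lowers the degree by
        -- 1.
        (λ s n g low → LowDegree-Δ-prime-power pp n 0 g low (divides (γ s i) (sym (ℤₚ.*-identityʳ (γ s i)))))
        (suc (d i)) (δ (p ^ f i))
        (subst (λ n → LowDegree p n (δ (p ^ f i))) (sym (ℕₚ.m+[n∸m]≡n (ℕₚ.m^n>0 p (f i)))) (δ-lowDegree pp (f i))) 0ℤ)

    -- The factors have weighted degree at most `0`, `p ^ (v + h) - 1` and `p ^ v · total r d`. One
    -- more than the sum of these is exactly the bound that `weight-bound` supplies.
    summand-low : ∀ x → LowWeight p k (weight x) (p ^ v ℕ.* (total r d ℕ.+ p ^ h)) (summand x)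
    summand-low x = subst (λ n → LowWeight p k (weight x) n (summand x)) degree
      (LowWeight-* k 0 (ℕ.pred q ℕ.+ total r (λ i → p ^ v ℕ.* d i))
        (periodic-pullback k (λ s → (a s - x) * M s) ε (ε-step x) 0ℤ)
        (LowWeight-* k (ℕ.pred q) _
          (LowDegree-pullback k M (λ s n g → M-step x s g n) (suc (ℕ.pred q)) (δ q)
            (subst (λ n → LowDegree p n (δ q)) (sym 1+[q-1]≡q) (δ-lowDegree pp (v ℕ.+ h))) 0ℤ)
          (∏-LowWeight k r (λ i → p ^ v ℕ.* d i) _ (coordinate-low x))))
      where
      1+[q-1]≡q : suc (ℕ.pred q) ≡ q
      1+[q-1]≡q = ℕₚ.suc-pred q {{ℕₚ.m^n≢0 p (v ℕ.+ h)}}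
      open ≡-Reasoning
      degree : suc (ℕ.pred q ℕ.+ total r (λ i → p ^ v ℕ.* d i)) ≡ p ^ v ℕ.* (total r d ℕ.+ p ^ h)
      degree = begin
        suc (ℕ.pred q) ℕ.+ total r (λ i → p ^ v ℕ.* d i)
          ≡⟨ cong₂ ℕ._+_ (trans 1+[q-1]≡q (ℕₚ.^-distribˡ-+-* p v h)) (total-*ˡ r (p ^ v) d) ⟩
        p ^ v ℕ.* p ^ h ℕ.+ p ^ v ℕ.* total r d
          ≡⟨ lemma (p ^ v) (p ^ h) (total r d) ⟩
        p ^ v ℕ.* (total r d ℕ.+ p ^ h) ∎
        where
        lemma : ∀ a b c → a ℕ.* b ℕ.+ a ℕ.* c ≡ a ℕ.* (c ℕ.+ b)
        lemma = ℕSolver.solve-∀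

    detector : Subset k → ℤ
    detector I = Σ< N (λ x → summand (+ x) I)

    detector-alternating : + p ∣ alternating k detector
    detector-alternating = alternating-Σ< k N (λ x → summand (+ x))
      (λ x → LowWeight-alternating k (weight-bound cover (+ x)) (summand-low (+ x)))

    detector≡ : ∀ I → detector I ≡ average N (ΣI I M) ε (ΣI I (λ s → a s * M s)) * rest I
    detector≡ I = trans (Σ<-*ʳ N (λ x → ε (0ℤ + ΣI I (λ s → (a s - + x) * M s))) (rest I)) (cong (_* rest I)
      (Σ<-cong N (λ x → cong ε (trans (ℤₚ.+-identityˡ (ΣI I (λ s → (a s - + x) * M s))) (ΣI-affine I a M (+ x))))))

    detector-∅ : detector ∅ ≡ + N
    detector-∅ = trans (Σ<-cong N λ x → cong₂ _*_
        (trans (cong (λ z → ε (0ℤ + z)) (subsetSum-∅ _+_ 0ℤ k _)) fun0≡1)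
        (cong₂ _*_ (trans (cong (λ z → δ q (0ℤ + z)) (subsetSum-∅ _+_ 0ℤ k M)) (δ-∣ {q} (k∣0 (+ q))))
          (∏-1 r λ i → trans (cong (λ z → δ (p ^ f i) (0ℤ + z)) (subsetSum-∅ _+_ 0ℤ k _)) (δ-∣ {p ^ f i} (k∣0 (+ (p ^ f i)))))))
      (Σ<-1 N)

    -- By contraposition: if `N` does not divide `ΣI I M`, the average of `ε` vanishes; if another
    -- condition fails, an indicator in `rest` is 0.
    detects : ∀ I → ¬ + p ∣ detector I →
      + N ∣ ΣI I M × + q ∣ ΣI I M × (∀ i → + (p ^ f i) ∣ ΣI I (λ s → γ s i))
    detects I p∤ = by-contradiction N∣B , by-contradiction q∣B , λ i → by-contradiction (pf∣ i)
      where
      B = ΣI I M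
      A = ΣI I (λ s → a s * M s)
      by-contradiction : ∀ {z m} → (¬ z ∣ m → detector I ≡ 0ℤ) → z ∣ m
      by-contradiction {z} {m} vanish with z ∣? m
      ... | yes z∣m = z∣m
      ... | no z∤m = contradiction (subst (+ p ∣_) (sym (vanish z∤m)) (k∣0 (+ p))) p∤
      rest-vanish : rest I ≡ 0ℤ → detector I ≡ 0ℤ
      rest-vanish e = trans (detector≡ I) (trans (cong (_*_ (average N B ε A)) e) (ℤₚ.*-zeroʳ (average N B ε A)))
      N∣B : ¬ + N ∣ B → detector I ≡ 0ℤ
      N∣B N∤B = trans (detector≡ I) (trans (cong (_* rest I) (average≡0 B N∤B A)) (ℤₚ.*-zeroˡ (rest I)))
      q∣B : ¬ + q ∣ B → detector I ≡ 0ℤ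
      q∣B q∤B = rest-vanish (trans (cong (_* Π) (δ-∤ {q} (λ q∣ → q∤B (subst (+ q ∣_) (ℤₚ.+-identityˡ B) q∣))))
        (ℤₚ.*-zeroˡ Π))
        where Π = ∏ r (λ i → δ (p ^ f i) (0ℤ + ΣI I (λ s → γ s i)))
      pf∣ : ∀ i → ¬ + (p ^ f i) ∣ ΣI I (λ s → γ s i) → detector I ≡ 0ℤ
      pf∣ i ∤ = rest-vanish (trans (cong (_*_ (δ q (0ℤ + B))) (∏-0 r i
          (δ-∤ {p ^ f i} (λ ∣ → ∤ (subst (+ (p ^ f i) ∣_) (ℤₚ.+-identityˡ _) ∣)))))
        (ℤₚ.*-zeroʳ (δ q (0ℤ + B))))

    zero-sum-separated : ∃ λ I → Nonempty I × (∀ i → + (p ^ f i) ∣ ΣI I (λ s → γ s i)) ×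
      + (p ^ h ℕ.* (N ℕ.* p ^ v)) ∣ ΣI I M
    zero-sum-separated =
      let I , I≢∅ , p∤ = nonempty-witness k detector (λ p∣ → p∤N (∣⇒∣ᵤ (subst (+ p ∣_) detector-∅ p∣))) detector-alternating
          N∣ , q∣ , pf∣ = detects I p∤
      in I , I≢∅ , pf∣ , both N∣ q∣
      where
      -- `q = p ^ (v + h)` is coprime to `N`, so the two divisors combine to `q N`, which is `p ^ h`
      -- times `N p^v`.
      both : ∀ {B} → + N ∣ B → + q ∣ B → + (p ^ h ℕ.* (N ℕ.* p ^ v)) ∣ B
      both (divides b refl) q∣ = subst (_∣ b * + N) (cong +_ eq)
        (subst (_∣ b * + N) (sym (ℤₚ.pos-* q N))
          (*-monoˡ-∣ (+ N) {+ q} {b} (∣ᵤ⇒∣ {+ q} {b}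
          (prime∤⇒∣-cancel pp p∤N (v ℕ.+ h) ℤ.∣ b ∣
            (subst (q ℕD.∣_) (trans (ℤₚ.abs-* b (+ N)) (ℕₚ.*-comm ℤ.∣ b ∣ N)) (∣⇒∣ᵤ q∣))))))
        where
        eq : q ℕ.* N ≡ p ^ h ℕ.* (N ℕ.* p ^ v)
        eq = trans (cong (ℕ._* N) (ℕₚ.^-distribˡ-+-* p v h)) (lemma (p ^ v) (p ^ h) N)
          where
          lemma : ∀ a b c → a ℕ.* b ℕ.* c ≡ b ℕ.* (c ℕ.* a)
          lemma = ℕSolver.solve-∀

    M-scale : ∀ s → m s * + (N ℕ.* p ^ v) ≡ M s * + n s
    M-scale s = begin
      m s * + (N ℕ.* p ^ v)
        ≡⟨ cong₂ (λ a b → m s * + (a ℕ.* b)) (N≡ s) (trans (cong (p ^_) (v≡ s)) (ℕₚ.^-distribˡ-+-* p (e s) (u s))) ⟩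
      m s * + (n′ s ℕ.* t s ℕ.* (p ^ e s ℕ.* p ^ u s))
        ≡⟨ cong (_*_ (m s)) (trans (ℤₚ.pos-* (n′ s ℕ.* t s) (p ^ e s ℕ.* p ^ u s))
             (cong₂ _*_ (ℤₚ.pos-* (n′ s) (t s)) (ℤₚ.pos-* (p ^ e s) (p ^ u s)))) ⟩
      m s * (+ n′ s * + t s * (+ (p ^ e s) * + (p ^ u s)))
        ≡⟨ lemma (m s) (+ n′ s) (+ t s) (+ (p ^ e s)) (+ (p ^ u s)) ⟩
      M s * (+ n′ s * + (p ^ u s))
        ≡⟨ cong (_*_ (M s)) (trans (sym (ℤₚ.pos-* (n′ s) (p ^ u s))) (cong +_ (sym (n≡ s)))) ⟩
      M s * + n s ∎
      where
      open ≡-Reasoning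
      lemma : ∀ m n t e u → m * (n * t * (e * u)) ≡ m * t * e * (n * u)
      lemma = solve-∀

    M-denominator≢0 : NonZero (N ℕ.* p ^ v)
    M-denominator≢0 = ℕₚ.m*n≢0 N (p ^ v) {{N≢0}} {{ℕₚ.m^n≢0 p v}}

  -- `T` is a common denominator with `m s / n s = M s / T`; the last divisibility thus says that
  -- the sum of the fractions is a multiple of `p ^ h`.
  integral-zero-sum : ∀ {p} → Prime p → ∀ h r (f : Fin r → ℕ) k a n → (∀ s → NonZero (n s)) →
    IsMCover (total r (λ i → p ^ f i ∸ 1) ℕ.+ p ^ h) k a n →
    (γ : Fin k → Fin r → ℤ) (m : Fin k → ℤ) →
    ∃ λ I → Nonempty I × (∀ i → + (p ^ f i) ∣ ΣI I (λ s → γ s i)) ×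
    ∃ λ T → NonZero T × ∃ λ M → (∀ s → m s * + T ≡ M s * + n s) × + (p ^ h ℕ.* T) ∣ ΣI I M
  integral-zero-sum pp h r f k a n npos cover γ m =
    let I , I≢∅ , f∣ , ph∣ = zero-sum-separated
    in I , I≢∅ , f∣ , _ , M-denominator≢0 , M , M-scale , ph∣
    where open Detector pp (separate pp k n npos) a m h r f γ cover

open IntegralZeroSum
open import Data.Nat using (_+_)

-- Finite abelian p-groups in coordinates

dstarOf≡total : ∀ r ds → dstarOf r ds ≡ total r (λ i → ds i ∸ 1)
dstarOf≡total r ds = trans (cong sum (map-tabulate id (λ i → ds i ∸ 1))) (sum-tabulate r (λ i → ds i ∸ 1))
  where
  sum-tabulate : ∀ r (g : Fin r → ℕ) → sum (tabulate g) ≡ total r g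
  sum-tabulate zero    g = refl
  sum-tabulate (suc r) g = cong (g zero ℕ.+_) (sum-tabulate r (g ∘ suc))

-- Write `d = n p^u` with `p` not dividing `n`. From `p ^ e = n (t p^u)` it follows that
-- `p ^ e ∣ t p^u`, so `n p^e` divides `p ^ e` and `n = 1`.
∣prime-power : ∀ {p} → Prime p → ∀ d e → d ℕD.∣ p ^ e → ∃ λ f → d ≡ p ^ f
∣prime-power {p} pp d e (ℕD.divides t p^e≡td)
  with p-part pp d {{ℕₚ.m*n≢0⇒n≢0 t {{subst NonZero p^e≡td (ℕₚ.m^n≢0 p e {{prime⇒nonZero pp}})}}}}
... | n , u , d≡ , p∤n = u , trans d≡ (trans (cong (ℕ._* p ^ u) n≡1) (ℕₚ.*-identityˡ (p ^ u)))
  where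
  open ≡-Reasoning
  n[tp^u]≡p^e : n ℕ.* (t ℕ.* p ^ u) ≡ p ^ e
  n[tp^u]≡p^e = sym (trans p^e≡td (trans (cong (t ℕ.*_) d≡) (lemma t n (p ^ u))))
    where
    lemma : ∀ a b c → a ℕ.* (b ℕ.* c) ≡ b ℕ.* (a ℕ.* c)
    lemma = ℕSolver.solve-∀
  p^e∣ : p ^ e ℕD.∣ t ℕ.* p ^ u
  p^e∣ = prime∤⇒∣-cancel pp p∤n e (t ℕ.* p ^ u) (ℕD.∣-reflexive (sym n[tp^u]≡p^e))
  n≡1 : n ≡ 1
  n≡1 = ℕD.∣1⇒≡1 (ℕD.*-cancelʳ-∣ (p ^ e) {{ℕₚ.m^n≢0 p e {{prime⇒nonZero pp}}}}
    (subst (n ℕ.* p ^ e ℕD.∣_) (trans n[tp^u]≡p^e (sym (ℕₚ.*-identityˡ (p ^ e)))) (ℕD.*-monoʳ-∣ n p^e∣)))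

module Coordinates {c ℓ : Level} (G : AbelianGroup c ℓ) (r : ℕ) (ds : Fin r → ℕ) (iso : IsoToSum G r ds) where
  open AbelianGroup G using (Carrier; _≈_; _∙_; ε; rawGroup)
  open GroupMorphisms rawGroup (ZSum r ds)

  φ : Carrier → Fin r → ℤ
  φ = proj₁ iso
  open IsGroupIsomorphism (proj₂ iso) using (⟦⟧-cong; ∙-homo; ε-homo; injective; surjective)

  φ-cong : ∀ {x y} → x ≈ y → ∀ i → φ x i ≡[ ds i ] φ y i
  φ-cong {x} {y} x≈y i = ∣⇒≡[] (∣ᵤ⇒∣ {+ ds i} {φ x i ℤ.- φ y i} (⟦⟧-cong x≈y i))

  φ-∙ : ∀ x y i → φ (x ∙ y) i ≡[ ds i ] φ x i ℤ.+ φ y i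
  φ-∙ x y i = ∣⇒≡[] (∣ᵤ⇒∣ {+ ds i} {φ (x ∙ y) i ℤ.- (φ x i ℤ.+ φ y i)} (∙-homo x y i))

  φ-ε : ∀ i → φ ε i ≡[ ds i ] 0ℤ
  φ-ε i = ∣⇒≡[] (∣ᵤ⇒∣ {+ ds i} {φ ε i ℤ.- 0ℤ} (ε-homo i))

  φ-natMul : ∀ m x i → φ (natMul G m x) i ≡[ ds i ] + m ℤ.* φ x i
  φ-natMul zero    x i = ≡[]-trans (φ-ε i) (≡⇒≡[] (sym (ℤₚ.*-zeroˡ (φ x i))))
  φ-natMul (suc m) x i = ≡[]-trans (φ-∙ x (natMul G m x) i)
    (≡[]-trans (≡[]-+ {ds i} {φ x i} (≡⇒≡[] refl) (φ-natMul m x i)) (≡⇒≡[] (lemma (+ m) (φ x i))))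
    where
    lemma : ∀ m x → x ℤ.+ m ℤ.* x ≡ (1ℤ ℤ.+ m) ℤ.* x
    lemma = solve-∀

  φ-subsetSum : ∀ {k} (I : Subset k) cs i → φ (subsetSum _∙_ ε I cs) i ≡[ ds i ] ΣI I (λ s → φ (cs s) i)
  φ-subsetSum []          cs i = φ-ε i
  φ-subsetSum (false ∷ I) cs i = φ-subsetSum I (cs ∘ suc) i
  φ-subsetSum (true ∷ I)  cs i = ≡[]-trans (φ-∙ (cs zero) (subsetSum _∙_ ε I (cs ∘ suc)) i)
    (≡[]-+ {ds i} {φ (cs zero) i} (≡⇒≡[] refl) (φ-subsetSum I (cs ∘ suc) i))

  ∣φ⇒≈ε : ∀ x → (∀ i → + ds i ∣ φ x i) → x ≈ ε
  ∣φ⇒≈ε x d∣ = injective λ i → ∣⇒∣ᵤ (∣m∣n⇒∣m-n (d∣ i)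
    (≡[]-∣ (≡[]-sym (φ-ε i)) (k∣0 (+ ds i))))

  unit : Fin r → Fin r → ℤ
  unit i j = if does (i Fin.≟ j) then 1ℤ else 0ℤ

  unit-diagonal : ∀ i → unit i i ≡ 1ℤ
  unit-diagonal i with i Fin.≟ i
  ... | yes _  = refl
  ... | no i≢i = contradiction refl i≢i

  -- A preimage of the `i`-th unit vector is annihilated by some `p ^ e`; reading off coordinate `i`
  -- gives `ds i ∣ p ^ e`.
  prime-power-factors : ∀ {p} → Prime p → IsPGroup G p → ∀ i → ∃ λ f → ds i ≡ p ^ f
  prime-power-factors {p} pp pG i =
    let g , φg≈unit = surjective (unit i)
        e , p^eg≈ε = pG g
        φg≡1 : φ g i ≡[ ds i ] 1ℤ
        φg≡1 = ≡[]-trans (∣⇒≡[] (∣ᵤ⇒∣ {+ ds i} {φ g i ℤ.- unit i i} (φg≈unit {g} (AbelianGroup.refl G) i))) (≡⇒≡[] (unit-diagonal i))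
        p^eφg≡0 : + (p ^ e) ℤ.* φ g i ≡[ ds i ] 0ℤ
        p^eφg≡0 = ≡[]-trans (≡[]-sym (φ-natMul (p ^ e) g i)) (≡[]-trans (φ-cong p^eg≈ε i) (φ-ε i))
        p^e≡0 : + ds i ∣ + (p ^ e)
        p^e≡0 = subst (+ ds i ∣_) (lemma (+ (p ^ e)) (φ g i))
          (∣m∣n⇒∣m-n (≡[]⇒∣ p^eφg≡0) (∣n⇒∣m*n (+ (p ^ e)) (≡[]⇒∣ φg≡1)))
    in ∣prime-power pp (ds i) e (∣⇒∣ᵤ p^e≡0)
    where
    lemma : ∀ a x → (a ℤ.* x ℤ.- 0ℤ) ℤ.- a ℤ.* (x ℤ.- 1ℤ) ≡ a
    lemma = solve-∀

-- Arithmetic of fractions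

/-≡ : ∀ a b c d .{{_ : NonZero b}} .{{_ : NonZero d}} → a ℤ.* + d ≡ c ℤ.* + b → a / b ≡ c / d
/-≡ a (suc b) c (suc d) eq = ℚₚ.fromℚᵘ-cong {mkℚᵘ a b} {mkℚᵘ c d} (*≡* eq)

/-+ : ∀ a b T .{{_ : NonZero T}} → a / T ℚ.+ b / T ≡ (a ℤ.+ b) / T
/-+ a b (suc T) = ℚₚ.toℚᵘ-injective (begin
  ℚ.toℚᵘ (a / suc T ℚ.+ b / suc T)                ≈⟨ ℚₚ.toℚᵘ-homo-+ (a / suc T) (b / suc T) ⟩
  ℚ.toℚᵘ (a / suc T) ℚᵘ.+ ℚ.toℚᵘ (b / suc T)      ≈⟨ ℚᵘₚ.+-cong (ℚₚ.toℚᵘ-fromℚᵘ (mkℚᵘ a T)) (ℚₚ.toℚᵘ-fromℚᵘ (mkℚᵘ b T)) ⟩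
  mkℚᵘ a T ℚᵘ.+ mkℚᵘ b T                          ≈⟨ *≡* (trans (lemma a b (+ suc T)) (cong ((a ℤ.+ b) ℤ.*_) (sym (ℤₚ.pos-* (suc T) (suc T))))) ⟩
  mkℚᵘ (a ℤ.+ b) T                                ≈⟨ ℚₚ.toℚᵘ-fromℚᵘ (mkℚᵘ (a ℤ.+ b) T) ⟨
  ℚ.toℚᵘ ((a ℤ.+ b) / suc T)                      ∎)
  where
  open ℚᵘₚ.≃-Reasoning
  lemma : ∀ a b T → (a ℤ.* T ℤ.+ b ℤ.* T) ℤ.* T ≡ (a ℤ.+ b) ℤ.* (T ℤ.* T)
  lemma = solve-∀

/1-* : ∀ a b → (a / 1) ℚ.* (b / 1) ≡ (a ℤ.* b) / 1
/1-* a b = ℚₚ.toℚᵘ-injective (begin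
  ℚ.toℚᵘ ((a / 1) ℚ.* (b / 1))            ≈⟨ ℚₚ.toℚᵘ-homo-* (a / 1) (b / 1) ⟩
  ℚ.toℚᵘ (a / 1) ℚᵘ.* ℚ.toℚᵘ (b / 1)      ≈⟨ ℚᵘₚ.*-cong (ℚₚ.toℚᵘ-fromℚᵘ (mkℚᵘ a 0)) (ℚₚ.toℚᵘ-fromℚᵘ (mkℚᵘ b 0)) ⟩
  mkℚᵘ (a ℤ.* b) 0                        ≈⟨ ℚₚ.toℚᵘ-fromℚᵘ (mkℚᵘ (a ℤ.* b) 0) ⟨
  ℚ.toℚᵘ ((a ℤ.* b) / 1)                  ∎)
  where open ℚᵘₚ.≃-Reasoning

/-neg : ∀ a T .{{_ : NonZero T}} → ℚ.- (a / T) ≡ (ℤ.- a) / T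
/-neg a T = sym (inverseˡ-unique ((ℤ.- a) / T) (a / T)
  (trans (/-+ (ℤ.- a) a T) (trans (cong (λ z → z / T) (ℤₚ.+-inverseˡ a)) (ℚₚ.0/n≡0 T))))
  where open AbelianGroupProperties ℚₚ.+-0-abelianGroup using (inverseˡ-unique)

subsetSum-/ : ∀ {k} (I : Subset k) (M : Fin k → ℤ) T .{{_ : NonZero T}} →
  subsetSum ℚ._+_ 0ℚ I (λ s → M s / T) ≡ ΣI I M / T
subsetSum-/ []          M T = sym (ℚₚ.0/n≡0 T)
subsetSum-/ (false ∷ I) M T = subsetSum-/ I (M ∘ suc) T
subsetSum-/ (true ∷ I)  M T = trans (cong ((M zero / T) ℚ.+_) (subsetSum-/ I (M ∘ suc) T))
  (/-+ (M zero) (ΣI I (M ∘ suc)) T)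

subsetSum-cong : ∀ {a} {A : Set a} {_+_ : A → A → A} {e k} (I : Subset k) {f g : Fin k → A} →
  (∀ s → f s ≡ g s) → subsetSum _+_ e I f ≡ subsetSum _+_ e I g
subsetSum-cong []          f≡g = refl
subsetSum-cong (false ∷ I) f≡g = subsetSum-cong I (f≡g ∘ suc)
subsetSum-cong {_+_ = _+_} (true ∷ I) f≡g = cong₂ _+_ (f≡g zero) (subsetSum-cong I (f≡g ∘ suc))

-- Symmetric differences of subsets and sign changes

infixl 6 _⊕_

_⊕_ : ∀ {k} → Subset k → Subset k → Subset k
_⊕_ = zipWith _xor_

⊕-≢ : ∀ {k} (I J : Subset k) → Nonempty J → ¬ I ⊕ J ≡ I
⊕-≢ (true  ∷ I) (true ∷ J) (zero , here) ()
⊕-≢ (false ∷ I) (true ∷ J) (zero , here) ()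
⊕-≢ (x ∷ I) (y ∷ J) (suc s , there s∈J) eq = ⊕-≢ I J (s , s∈J) (cong tail eq)

flipOn : ∀ {a} {A : Set a} → (A → A) → ∀ {k} → Subset k → (Fin k → A) → Fin k → A
flipOn neg I f s = if lookup I s then neg (f s) else f s

module _ {c ℓ : Level} (G : AbelianGroup c ℓ) where
  open AbelianGroup G renaming (refl to ≈-refl; sym to ≈-sym; trans to ≈-trans)
  open CommutativeSemigroupProperties commutativeSemigroup using (interchange; x∙yz≈y∙xz)
  open import Relation.Binary.Reasoning.Setoid setoid

  -- An index of `J` outside `I` is added to `I`; one inside `I` is removed from it, which amounts
  -- to adding the inverse of its term.
  subsetSum-⊕ : ∀ {k} (I J : Subset k) (f : Fin k → Carrier) →
    subsetSum _∙_ ε (I ⊕ J) f ≈ subsetSum _∙_ ε I f ∙ subsetSum _∙_ ε J (flipOn _⁻¹ I f)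
  subsetSum-⊕ [] [] f = ≈-sym (identityʳ ε)
  subsetSum-⊕ (false ∷ I) (false ∷ J) f = subsetSum-⊕ I J (f ∘ suc)
  subsetSum-⊕ (false ∷ I) (true ∷ J)  f = ≈-trans (∙-congˡ (subsetSum-⊕ I J (f ∘ suc)))
    (x∙yz≈y∙xz (f zero) (subsetSum _∙_ ε I (f ∘ suc)) _)
  subsetSum-⊕ (true ∷ I)  (false ∷ J) f = ≈-trans (∙-congˡ (subsetSum-⊕ I J (f ∘ suc)))
    (≈-sym (assoc (f zero) (subsetSum _∙_ ε I (f ∘ suc)) _))
  subsetSum-⊕ (true ∷ I)  (true ∷ J)  f = begin
    subsetSum _∙_ ε (I ⊕ J) (f ∘ suc)             ≈⟨ subsetSum-⊕ I J (f ∘ suc) ⟩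
    A ∙ B                                         ≈⟨ identityˡ (A ∙ B) ⟨
    ε ∙ (A ∙ B)                                   ≈⟨ ∙-congʳ (inverseʳ (f zero)) ⟨
    (f zero ∙ f zero ⁻¹) ∙ (A ∙ B)                ≈⟨ interchange (f zero) (f zero ⁻¹) A B ⟩
    (f zero ∙ A) ∙ (f zero ⁻¹ ∙ B)                ∎
    where
    A = subsetSum _∙_ ε I (f ∘ suc)
    B = subsetSum _∙_ ε J (flipOn _⁻¹ I (f ∘ suc))

flipOn-/ : ∀ {k} (I : Subset k) (m : Fin k → ℤ) (n : Fin k → ℕ) (npos : ∀ s → NonZero (n s)) s →
  _/_ (flipOn ℤ.-_ I m s) (n s) {{npos s}} ≡ flipOn ℚ.-_ I (λ s → _/_ (m s) (n s) {{npos s}}) s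
flipOn-/ I m n npos s with lookup I s
... | true  = sym (/-neg (m s) (n s) {{npos s}})
... | false = refl

-- Zero sums and non-uniqueness in a finite abelian `p`-group

zero-sum : ∀ {c ℓ} {p} → Prime p → (G : AbelianGroup c ℓ) → IsPGroup G p → ∀ {D} → DStar G D →
  ∀ h k a n (npos : ∀ s → NonZero (n s)) → IsMCover (D + p ^ h) k a n →
  (cs : Fin k → AbelianGroup.Carrier G) (ms : Fin k → ℤ) →
  let open AbelianGroup G in
  ∃ λ I → Nonempty I × subsetSum _∙_ ε I cs ≈ ε ×
    ∃ λ z → subsetSum ℚ._+_ 0ℚ I (λ s → _/_ (ms s) (n s) {{npos s}}) ≡ (z / 1) ℚ.* ((+ (p ^ h)) / 1)
zero-sum {p = p} pp G pG (r , ds , _ , iso , refl) h k a n npos cover cs ms =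
  conclude (integral-zero-sum pp h r f k a n npos cover′ (λ s → φ (cs s)) ms)
  where
  open AbelianGroup G using (_∙_; ε; _≈_)
  open Coordinates G r ds iso
  f : Fin r → ℕ
  f i = proj₁ (prime-power-factors pp pG i)
  ds≡ : ∀ i → ds i ≡ p ^ f i
  ds≡ i = proj₂ (prime-power-factors pp pG i)
  total-cong : ∀ r {f g : Fin r → ℕ} → (∀ i → f i ≡ g i) → total r f ≡ total r g
  total-cong zero    e = refl
  total-cong (suc r) e = cong₂ _+_ (e zero) (total-cong r (e ∘ suc))
  cover′ : IsMCover (total r (λ i → p ^ f i ∸ 1) + p ^ h) k a n
  cover′ = subst (λ D → IsMCover (D + p ^ h) k a n)
    (trans (dstarOf≡total r ds) (total-cong r (λ i → cong (_∸ 1) (ds≡ i)))) cover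
  conclude : (∃ λ I → Nonempty I × (∀ i → + (p ^ f i) ∣ ΣI I (λ s → φ (cs s) i)) ×
      ∃ λ T → NonZero T × ∃ λ M → (∀ s → ms s ℤ.* + T ≡ M s ℤ.* + n s) × + (p ^ h ℕ.* T) ∣ ΣI I M) →
    ∃ λ I → Nonempty I × subsetSum _∙_ ε I cs ≈ ε ×
    ∃ λ z → subsetSum ℚ._+_ 0ℚ I (λ s → _/_ (ms s) (n s) {{npos s}}) ≡ (z / 1) ℚ.* ((+ (p ^ h)) / 1)
  conclude (I , I≢∅ , d∣ , T , T≢0 , M , scale , divides z ΣM≡) =
    I , I≢∅ , ∣φ⇒≈ε (subsetSum _∙_ ε I cs) coordinates , z , (begin
      subsetSum ℚ._+_ 0ℚ I (λ s → _/_ (ms s) (n s) {{npos s}})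
        ≡⟨ subsetSum-cong I (λ s → /-≡ (ms s) (n s) (M s) T {{npos s}} {{T≢0}} (scale s)) ⟩
      subsetSum ℚ._+_ 0ℚ I (λ s → _/_ (M s) T {{T≢0}})
        ≡⟨ subsetSum-/ I M T {{T≢0}} ⟩
      _/_ (ΣI I M) T {{T≢0}}
        ≡⟨ /-≡ (ΣI I M) T (z ℤ.* + (p ^ h)) 1 {{T≢0}} integral ⟩
      (z ℤ.* + (p ^ h)) / 1
        ≡⟨ sym (/1-* z (+ (p ^ h))) ⟩
      (z / 1) ℚ.* ((+ (p ^ h)) / 1) ∎)
    where
    open ≡-Reasoning
    coordinates : ∀ i → + ds i ∣ φ (subsetSum _∙_ ε I cs) i
    coordinates i = ≡[]-∣ (≡[]-sym (φ-subsetSum I cs i)) (subst (λ d → + d ∣ ΣI I (λ s → φ (cs s) i)) (sym (ds≡ i)) (d∣ i))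
    integral : ΣI I M ℤ.* 1ℤ ≡ z ℤ.* + (p ^ h) ℤ.* + T
    integral = trans (ℤₚ.*-identityʳ (ΣI I M)) (trans ΣM≡
      (trans (cong (z ℤ.*_) (ℤₚ.pos-* (p ^ h) T)) (sym (ℤₚ.*-assoc z (+ (p ^ h)) (+ T)))))

theorem2p1 : ∀ {c ℓ : Level}
    (p : ℕ) → Prime p →
    (G : AbelianGroup c ℓ) → IsPGroup G p →
    (D : ℕ) → DStar G D →
    (h : ℕ) →
    (k : ℕ) (a : Fin k → ℤ) (n : Fin k → ℕ) (npos : (s : Fin k) → NonZero (n s)) →
    IsMCover (D + p ^ h) k a n →
    (cs : Fin k → AbelianGroup.Carrier G) (ms : Fin k → ℤ) →
    let open AbelianGroup G
        sumG : Subset k → Carrier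
        sumG I = subsetSum _∙_ ε I cs
        sumQ : Subset k → ℚ
        sumQ I = subsetSum ℚ._+_ 0ℚ I (λ s → _/_ (ms s) (n s) {{npos s}})
        ph : ℚ
        ph = (+ (p ^ h)) / 1
    in ((c : Carrier) (α : ℚ) →
         let P : Subset k → Set _
             P I = (sumG I ≈ c) × (∃ λ (z : ℤ) → sumQ I ≡ α ℚ.+ ((z / 1) ℚ.* ph))
         in ¬ (∃ λ I → P I × ((J : Subset k) → P J → J ≡ I)))
       × (∃ λ I → Nonempty I × (sumG I ≈ ε) × (∃ λ (z : ℤ) → sumQ I ≡ (z / 1) ℚ.* ph))
theorem2p1 p pp G pG D dstar h k a n npos cover cs ms = not-unique , zero-sum pp G pG dstar h k a n npos cover cs ms
  where
  open AbelianGroup G using (Carrier; _≈_; _∙_; ε; _⁻¹; ∙-cong; identityʳ) renaming (trans to ≈-trans)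
  sumQ : Subset k → ℚ
  sumQ I = subsetSum ℚ._+_ 0ℚ I (λ s → _/_ (ms s) (n s) {{npos s}})
  ph : ℚ
  ph = (+ (p ^ h)) / 1
  P : Carrier → ℚ → Subset k → Set _
  P c α I = (subsetSum _∙_ ε I cs ≈ c) × (∃ λ (z : ℤ) → sumQ I ≡ α ℚ.+ ((z / 1) ℚ.* ph))
  not-unique : ∀ c α → ¬ (∃ λ I → P c α I × (∀ J → P c α J → J ≡ I))
  not-unique c α (I , (ΣI≈c , z , ΣI≡) , unique)
    -- Inverting terms on `I` leaves the cover as it is, so a nonempty zero-sum `J` exists for the
    -- changed data; `I ⊕ J` then meets the same two conditions as `I`.
    with zero-sum pp G pG dstar h k a n npos cover (flipOn _⁻¹ I cs) (flipOn ℤ.-_ I ms)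
  ... | J , J≢∅ , ΣJ≈ε , z′ , ΣJ≡ = ⊕-≢ I J J≢∅ (unique (I ⊕ J)
    ( ≈-trans (subsetSum-⊕ G I J cs) (≈-trans (∙-cong ΣI≈c ΣJ≈ε) (identityʳ c))
    , z ℤ.+ z′ , (begin
      sumQ (I ⊕ J)
        ≡⟨ subsetSum-⊕ ℚₚ.+-0-abelianGroup I J _ ⟩
      sumQ I ℚ.+ subsetSum ℚ._+_ 0ℚ J (flipOn ℚ.-_ I (λ s → _/_ (ms s) (n s) {{npos s}}))
        ≡⟨ cong (sumQ I ℚ.+_) (subsetSum-cong J (λ s → sym (flipOn-/ I ms n npos s))) ⟩
      sumQ I ℚ.+ subsetSum ℚ._+_ 0ℚ J (λ s → _/_ (flipOn ℤ.-_ I ms s) (n s) {{npos s}})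
        ≡⟨ cong₂ ℚ._+_ ΣI≡ ΣJ≡ ⟩
      (α ℚ.+ (z / 1) ℚ.* ph) ℚ.+ (z′ / 1) ℚ.* ph
        ≡⟨ ℚₚ.+-assoc α _ _ ⟩
      α ℚ.+ ((z / 1) ℚ.* ph ℚ.+ (z′ / 1) ℚ.* ph)
        ≡⟨ cong (α ℚ.+_) (sym (ℚₚ.*-distribʳ-+ ph (z / 1) (z′ / 1))) ⟩
      α ℚ.+ ((z / 1) ℚ.+ (z′ / 1)) ℚ.* ph
        ≡⟨ cong (λ t → α ℚ.+ t ℚ.* ph) (/-+ z z′ 1) ⟩
      α ℚ.+ ((z ℤ.+ z′) / 1) ℚ.* ph ∎)))
    where open ≡-Reasoning
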